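{- Let $\mathcal{A}$ be a central and essential arrangement in $\mathbb{Q}^l$ as in the context, $\sigma$ a term ordering and $p$ a prime. If $p$ is $(\sigma,2)$-lucky for $\mathcal{A}$, then $p$ is good for $\mathcal{A}$.
   Context: $\mathcal{A}=\{H_1,\dots,H_n\}$: $n$ distinct linear hyperplanes in $\mathbb{Q}^l$ with $\bigcap H_i=\{0\}$, $H_i=\{\alpha_i=0\}$, $\alpha_i\in\mathbb{Z}[x_1,\dots,x_l]$ a nonzero linear form whose coefficients are not all divisible by any prime, $Q(\mathcal{A})=\prod\alpha_i$. $p$ is good for $\mathcal{A}$ if the reduction of $Q(\mathcal{A})$ mod $p$ is reduced, equivalently the reductions $(\alpha_i)_p,(\alpha_j)_p$ are not scalar multiples of one another for all $i<j$. For a term ordering $\sigma$ and nonzero $f\in\mathbb{Z}[x_1,\dots,x_l]$, $\mathrm{LM}_\sigma(f)$ is the $\sigma$-leading term times its coefficient $\mathrm{LC}_\sigma(f)$. A minimal strong $\sigma$-Gröbner basis of an ideal $I\subseteq\mathbb{Z}[x_1,\dots,x_l]$ is a finite generating set $G$ of nonzero elements of $I$ such that every nonzero $f\in I$ has $\mathrm{LM}_\sigma(f)$ divisible by some $\mathrm{LM}_\sigma(g)$, $g\in G$, and no $\mathrm{LM}_\sigma(g)$ divides $\mathrm{LM}_\sigma(g')$ for distinct $g,g'$; its set of leading coefficients is independent of the choice. $p$ is $\sigma$-lucky for $I$ if it divides none of them. For $1\le k\le n$, $p$ is $(\sigma,k)$-lucky for $\mathcal{A}$ if it is $\sigma$-lucky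 for every ideal $\langle\alpha_{i_1},\dots,\alpha_{i_k}\rangle\subseteq\mathbb{Z}[x_1,\dots,x_l]$ with $i_1<\dots<i_k$ and $\operatorname{codim}(H_{i_1}\cap\dots\cap H_{i_k})=k$. -}

module Defs where

open import Algebra.Bundles.Raw using (RawSemiring)
import Algebra.Definitions.RawSemiring as SemiringDefs
open import Data.Bool.Base using (if_then_else_)
open import Data.Fin.Base as Fin using (Fin)
open import Data.Integer.Base as ℤ using (ℤ; +_; 0ℤ; 1ℤ)
import Data.Integer.Divisibility as ℤ
import Data.Integer.Properties as ℤ
open import Data.List.Base as List using (List; []; _∷_; [_]; _++_)
import Data.List.Extrema as Extrema
open import Data.Nat.Base as ℕ using (ℕ)
open import Data.Nat.Primality using (Prime)
import Data.Nat.Properties as ℕ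
open import Data.Product.Base using (Σ-syntax; ∃-syntax; _×_; _,_; proj₂)
open import Data.Rational.Base as ℚ using (ℚ; 0ℚ)
open import Data.Vec.Base as Vec using (Vec)
open import Data.Vec.Functional using (Vector)
import Data.Vec.Properties as Vec
open import Function.Base using (_∘_)
open import Level using (0ℓ; _⊔_)
open import Relation.Binary.Bundles using (TotalOrder)
open import Relation.Binary.Core using (Rel; _Preserves_⟶_)
open import Relation.Binary.Definitions using (DecidableEquality)
open import Relation.Binary.PropositionalEquality.Core using (_≡_; _≢_; _≗_)
open import Relation.Binary.Structures using (IsTotalOrder)
open import Relation.Nullary.Decidable.Core using (does; ¬?)
open import Relation.Nullary.Negation.Core using (¬_)
open import Relation.Unary using (Pred; _∈_; _≐_; ⋂)

------------------------------------------------------------------------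
-- Polynomials

-- The exponent vector of a power product x₁^a₁ ⋯ x_l^a_l.
Mon : ℕ → Set
Mon l = Vec ℕ l

_≟ᴹ_ : ∀ {l} → DecidableEquality (Mon l)
_≟ᴹ_ = Vec.≡-dec ℕ._≟_

1ᴹ : ∀ {l} → Mon l
1ᴹ = Vec.replicate _ 0

infixl 7 _*ᴹ_
_*ᴹ_ : ∀ {l} → Mon l → Mon l → Mon l
_*ᴹ_ = Vec.zipWith ℕ._+_

-- A formal sum of integer terms. Repeated power products and zero coefficients
-- are allowed, so polynomials are always compared through `coeff`.
Poly : ℕ → Set
Poly l = List (ℤ × Mon l)

coeff : ∀ {l} → Poly l → Mon l → ℤ
coeff []            m = 0ℤ
coeff ((c , a) ∷ f) m = (if does (a ≟ᴹ m) then c else 0ℤ) ℤ.+ coeff f m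

infixl 7 _*ᴾ_
_*ᴾ_ : ∀ {l} → Poly l → Poly l → Poly l
_*ᴾ_ = List.cartesianProductWith λ { (c , a) (d , b) → c ℤ.* d , a *ᴹ b }

ℤ[x] : ℕ → RawSemiring 0ℓ 0ℓ
ℤ[x] l = record
  { Carrier = Poly l
  ; _≈_     = λ f g → coeff f ≗ coeff g
  ; _+_     = _++_
  ; _*_     = _*ᴾ_
  ; 0#      = []
  ; 1#      = [ 1ℤ , 1ᴹ ]
  }

-- 𝔽ₚ[x₁,…,x_l] as ℤ[x₁,…,x_l] modulo p: the carrier is unchanged and equality
-- is congruence of coefficients, so reduction mod p is the identity on
-- representatives.
𝔽[x] : ℕ → ℕ → RawSemiring 0ℓ 0ℓ
𝔽[x] p l = record (ℤ[x] l)
  { _≈_ = λ f g → ∀ m → + p ℤ.∣ coeff f m ℤ.- coeff g m }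

-- Reduced, i.e. without multiple factors.
Squarefree : ∀ {a ℓ} (R : RawSemiring a ℓ) → Pred (RawSemiring.Carrier R) (a ⊔ ℓ)
Squarefree R f = ∀ {g} → g * g ∣ f → g ∣ 1#
  where
  open RawSemiring R
  open SemiringDefs R using (_∣_)

⟨_⟩ : ∀ {l k} → Vector (Poly l) k → Pred (Poly l) 0ℓ
⟨_⟩ {l} {k} g f = Σ[ q ∈ Vector (Poly l) k ] f ≈ sum λ i → q i * g i
  where
  open RawSemiring (ℤ[x] l)
  open SemiringDefs (ℤ[x] l) using (sum)

------------------------------------------------------------------------
-- Term orderings and Gröbner bases

record TermOrder (l : ℕ) : Set₁ where
  infix 4 _≼_
  field
    _≼_          : Rel (Mon l) 0ℓ
    isTotalOrder : IsTotalOrder _≡_ _≼_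
    1-minimum    : ∀ a → 1ᴹ ≼ a
    *-mono       : ∀ {a b} c → a ≼ b → a *ᴹ c ≼ b *ᴹ c

  totalOrder : TotalOrder 0ℓ 0ℓ 0ℓ
  totalOrder = record { isTotalOrder = isTotalOrder }

module _ {l : ℕ} (σ : TermOrder l) where

  open TermOrder σ using (totalOrder)
  open Extrema totalOrder using (max)

  support : Poly l → List (Mon l)
  support f = List.filter (λ m → ¬? (coeff f m ℤ.≟ 0ℤ)) (List.map proj₂ f)

  -- The leading power product. It is meaningful only for f ≉ 0; the default 1ᴹ
  -- is the least power product, so it does not affect the maximum.
  lpp : Poly l → Mon l
  lpp f = max 1ᴹ (support f)

  LC : Poly l → ℤ
  LC f = coeff f (lpp f)

  LM : Poly l → Poly l
  LM f = [ LC f , lpp f ]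

  -- The finite set G is given as a family; distinct elements are elements at
  -- distinct indices.
  record IsMinimalStrongGröbnerBasis {m} (I : Pred (Poly l) 0ℓ) (G : Vector (Poly l) m) : Set where
    open RawSemiring (ℤ[x] l) using (_≉_; 0#)
    open SemiringDefs (ℤ[x] l) using (_∣_; _∤_)
    field
      nonzero   : ∀ i → G i ≉ 0#
      generates : I ≐ ⟨ G ⟩
      strong    : ∀ {f} → f ∈ I → f ≉ 0# → ∃[ i ] LM (G i) ∣ LM f
      minimal   : ∀ {i j} → i ≢ j → LM (G i) ∤ LM (G j)

  -- Every ideal has a minimal strong Gröbner basis, and all of them have the
  -- same leading coefficients up to sign, so it does not matter which one is
  -- used here.
  IsLucky : ℕ → Pred (Poly l) 0ℓ → Set
  IsLucky p I = ∃[ m ] ∃[ G ]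
    IsMinimalStrongGröbnerBasis {m} I G × (∀ i → ¬ (+ p ℤ.∣ LC (G i)))

------------------------------------------------------------------------
-- Linear forms and subspaces of ℚˡ

-- The linear form ∑ⱼ aⱼxⱼ, given by its coefficients.
LinForm : ℕ → Set
LinForm l = Vector ℤ l

var : ∀ {l} → Fin l → Mon l
var j = 1ᴹ Vec.[ j ]≔ 1

toPoly : ∀ {l} → LinForm l → Poly l
toPoly a = List.tabulate λ j → a j , var j

open SemiringDefs ℚ.+-*-rawSemiring using () renaming (sum to ∑ℚ)

hyperplane : ∀ {l} → LinForm l → Pred (Vector ℚ l) 0ℓ
hyperplane a v = ∑ℚ (λ j → (a j ℚ./ 1) ℚ.* v j) ≡ 0ℚ

linComb : ∀ {l k} → Vector ℚ k → Vector (Vector ℚ l) k → Vector ℚ l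
linComb c b j = ∑ℚ λ i → c i ℚ.* b i j

-- codim W = k, i.e. dim (ℚˡ / W) = k: the classes of b form a basis of ℚˡ / W.
record HasCodim {l} (W : Pred (Vector ℚ l) 0ℓ) (k : ℕ) : Set where
  field
    b           : Vector (Vector ℚ l) k
    spanning    : ∀ (v : Vector ℚ l) → Σ[ c ∈ Vector ℚ k ] (λ j → v j ℚ.- linComb c b j) ∈ W
    independent : ∀ c → linComb c b ∈ W → ∀ i → c i ≡ 0ℚ

------------------------------------------------------------------------
-- Arrangements

-- Central essential arrangements of n hyperplanes in ℚˡ, with chosen primitive
-- integral defining forms.
record Arrangement (n l : ℕ) : Set where
  field
    α : Fin n → LinForm l

  H : Fin n → Pred (Vector ℚ l) 0ℓ
  H i = hyperplane (α i)

  field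
    nonzero   : ∀ i → ¬ (∀ j → α i j ≡ 0ℤ)
    coprime   : ∀ i {q} → Prime q → ¬ (∀ j → + q ℤ.∣ α i j)
    distinct  : ∀ {i j} → i ≢ j → ¬ (H i ≐ H j)
    essential : ∀ (v : Vector ℚ l) → v ∈ ⋂ (Fin n) H → ∀ j → v j ≡ 0ℚ

  Q : Poly l
  Q = product (toPoly ∘ α)
    where open SemiringDefs (ℤ[x] l) using (product)

module _ {n l : ℕ} (𝒜 : Arrangement n l) where

  open Arrangement 𝒜

  IsGood : ℕ → Set
  IsGood p = Squarefree (𝔽[x] p l) Q

  -- A strictly increasing s is a choice of indices i₁ < ⋯ < i_k; there is none
  -- when k > n.
  IsLuckyFor : TermOrder l → ℕ → ℕ → Set
  IsLuckyFor σ k p = ∀ (s : Fin k → Fin n) → s Preserves Fin._<_ ⟶ Fin._<_ →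
    HasCodim (⋂ (Fin k) (H ∘ s)) k → IsLucky σ p ⟨ toPoly ∘ α ∘ s ⟩

{-# OPTIONS --safe #-}

-- If α_i and α_j are proportional modulo p, then p h = u α_i + v α_j for an
-- integral linear form h and integers u, v not both divisible by p. Reducing p h
-- by a strong Gröbner basis of ⟨α_i, α_j⟩ whose leading coefficients are prime
-- to p shows that h itself lies in ⟨α_i, α_j⟩; only the linear part of the ideal
-- is involved, so the reduction ends after finitely many variables. As α_i and
-- α_j are independent over ℚ, p divides u and v, a contradiction.
--
-- So the α_i are pairwise non-associated modulo p. A nonzero linear form α over
-- 𝔽ₚ is prime, because f ≡ φ(f) modulo α for an endomorphism φ of 𝔽ₚ[x] killing
-- α, and 𝔽ₚ[x] is a domain. Hence the product of the α_i is squarefree.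
--
-- Equality of polynomials, given by coefficients, is handled through the pairing
-- ⟪ f , F ⟫ = ∑ c F(a) over the terms (c , a) of f: two polynomials are congruent
-- modulo p iff all their pairings are, which makes products and substitutions
-- visibly well defined.

module Submission where

open import Algebra.Bundles using (CommutativeRing; CommutativeSemiring)
open import Algebra.Definitions.RawMagma using (_,_)
import Algebra.Definitions.RawSemiring as SemiringDefs
import Algebra.Properties.CommutativeSemigroup as CommutativeSemigroupProperties
import Algebra.Properties.Monoid.Sum as MonoidSum
import Algebra.Properties.Semiring.Exp as Exp
import Algebra.Properties.Semiring.Sum as SemiringSum
import Algebra.Solver.CommutativeMonoid as CommutativeMonoidSolver
open import Algebra.Structures.Biased using (module IsCommutativeMonoidˡ; module IsCommutativeSemiringˡ)
open import Data.Bool.Base using (if_then_else_; true; false)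
open import Data.Fin.Base as Fin using (Fin; zero; suc)
open import Data.Fin.Induction using (po-wellFounded)
open import Data.Fin.Patterns using (0F; 1F)
import Data.Fin.Properties as Fin
open import Data.Integer.Base as ℤ using (ℤ; 0ℤ; 1ℤ)
open import Data.Integer.Divisibility.Signed as ℤ using (divides)
import Data.Integer.Properties as ℤ
open import Data.Integer.Tactic.RingSolver using (solve-∀)
open import Data.List.Base as List using (List; []; _∷_; [_]; _++_; length; filter)
import Data.List.Extrema as Extrema
open import Data.List.Membership.Propositional using (lose) renaming (_∈_ to _∈ˡ_)
open import Data.List.Membership.Propositional.Properties using (∈-filter⁺; ∈-filter⁻; ∈-tabulate⁻)
import Data.List.Properties as List
import Data.List.Relation.Unary.All as All
open import Data.List.Relation.Unary.Any as Any using (here; there)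
open import Data.Nat.Base as ℕ using (ℕ; zero; suc; s≤s⁻¹; z<s; s<s)
import Data.Nat.Coprimality as Coprimality
import Data.Nat.Divisibility as ℕᵈ
import Data.Nat.GCD as GCD
open import Data.Nat.Primality
  using (Prime; euclidsLemma; prime⇒irreducible; prime⇒nonTrivial; prime⇒nonZero)
import Data.Nat.Properties as ℕ
open import Data.Product.Base using (_,_; _×_; proj₁; proj₂; ∃-syntax; map₂)
open import Data.Rational.Base as ℚ using (ℚ; 0ℚ; 1ℚ; _/_; 1/_)
import Data.Rational.Properties as ℚ
open import Data.Rational.Solver using (module +-*-Solver)
open import Data.Rational.Unnormalised.Base as ℚᵘ using (mkℚᵘ)
import Data.Rational.Unnormalised.Properties as ℚᵘ
open import Data.Sum.Base as Sum using (_⊎_; inj₁; inj₂)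
open import Data.Vec.Base using ([]; _∷_)
open import Data.Vec.Functional using (Vector)
import Data.Vec.Properties as Vec
open import Function.Base using (_∘_)
open import Induction.WellFounded using (Acc; acc)
open import Level using (0ℓ)
open import Relation.Binary.Bundles using (Setoid)
open import Relation.Binary.Core using (_Preserves_⟶_)
import Relation.Binary.Reasoning.Setoid as SetoidReasoning
open import Relation.Binary.Structures using (IsEquivalence; IsPartialOrder; IsTotalOrder)
open import Relation.Nullary using (¬_; Dec; yes; no; does; contradiction)
open import Relation.Nullary.Decidable using (¬?; _⊎-dec_; dec-true; dec-false; decidable-stable)
open import Relation.Unary using (Pred; Decidable; _∈_; _⊆_; _≐_; ⋂)
open import Defs

private variable
  l n : ℕ

-- Products of primes

module _ {c ℓ} (R : CommutativeSemiring c ℓ) where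

  open CommutativeSemiring R hiding (zero)
  open SemiringDefs rawSemiring using (_∣_; _∤_; product) renaming (Prime to PrimeElement)
  open PrimeElement
  open SetoidReasoning setoid
  open CommutativeMonoidSolver *-commutativeMonoid using (solve; _⊕_; _⊜_)

  prime-∣-product : ∀ {p n} (f : Vector Carrier n) → PrimeElement p → p ∣ product f → ∃[ i ] p ∣ f i
  prime-∣-product {n = zero}  f prime p∣1  = contradiction p∣1 (p∤1 prime)
  prime-∣-product {n = suc n} f prime p∣∏f with split-∣ prime p∣∏f
  ... | inj₁ p∣f₀ = zero , p∣f₀
  ... | inj₂ p∣∏  with i , p∣fᵢ ← prime-∣-product (f ∘ suc) prime p∣∏ = suc i , p∣fᵢ

  -- If g² divides f₀ ⋯ fₙ, then f₀ divides g or the cofactor. The former would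
  -- make f₀ divide f₁ ⋯ fₙ, and in the latter case f₀ can be cancelled.
  squarefree-product : ∀ {n} (f : Vector Carrier n) →
    (∀ i → PrimeElement (f i)) → (∀ i {x y} → f i * x ≈ f i * y → x ≈ y) →
    (∀ {i j} → i Fin.< j → f i ∤ f j) →
    Squarefree rawSemiring (product f)
  squarefree-product {zero}  f prime cancel f∤f {g} (q , qg²≈1) =
    q * g , trans (*-assoc q g g) qg²≈1
  squarefree-product {suc n} f prime cancel f∤f {g} (q , qg²≈∏) = conclude
    where
    f₀ ∏f₊ : Carrier
    f₀  = f zero
    ∏f₊ = product (f ∘ suc)

    f₀∤g : f₀ ∤ g
    f₀∤g (r , rf₀≈g)
      with i , f₀∣fᵢ ← prime-∣-product (f ∘ suc) (prime zero) (q * (r * r) , cancel zero (begin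
        f₀ * (q * (r * r) * f₀)
          ≈⟨ solve 3 (λ a b c → a ⊕ ((b ⊕ (c ⊕ c)) ⊕ a) ⊜ b ⊕ ((c ⊕ a) ⊕ (c ⊕ a))) refl f₀ q r ⟩
        q * (r * f₀ * (r * f₀))  ≈⟨ *-congˡ (*-cong rf₀≈g rf₀≈g) ⟩
        q * (g * g)              ≈⟨ qg²≈∏ ⟩
        f₀ * ∏f₊                 ∎)) = f∤f z<s f₀∣fᵢ

    f₀∣ggq : f₀ ∣ g * (g * q)
    f₀∣ggq = ∏f₊ , (begin
      ∏f₊ * f₀     ≈⟨ *-comm ∏f₊ f₀ ⟩
      f₀ * ∏f₊     ≈⟨ qg²≈∏ ⟨
      q * (g * g)  ≈⟨ solve 2 (λ a b → a ⊕ (b ⊕ b) ⊜ b ⊕ (b ⊕ a)) refl q g ⟩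
      g * (g * q)  ∎)

    conclude : g ∣ 1#
    conclude with split-∣ (prime zero) f₀∣ggq
    ... | inj₁ f₀∣g  = contradiction f₀∣g f₀∤g
    ... | inj₂ f₀∣gq with split-∣ (prime zero) f₀∣gq
    ...   | inj₁ f₀∣g        = contradiction f₀∣g f₀∤g
    ...   | inj₂ (r , rf₀≈q) =
      squarefree-product (f ∘ suc) (prime ∘ suc) (cancel ∘ suc) (f∤f ∘ s<s) (r , cancel zero (begin
        f₀ * (r * (g * g))  ≈⟨ solve 3 (λ a b c → a ⊕ (b ⊕ c) ⊜ (b ⊕ a) ⊕ c) refl f₀ r (g * g) ⟩
        r * f₀ * (g * g)    ≈⟨ *-congʳ rf₀≈q ⟩
        q * (g * g)         ≈⟨ qg²≈∏ ⟩
        f₀ * ∏f₊            ∎))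

-- Evaluation of power products

module _ {c ℓ} (R : CommutativeSemiring c ℓ) where

  open CommutativeSemiring R hiding (zero)
  open SemiringDefs rawSemiring using (sum; _^_)
  open Exp semiring using (^-homo-*)
  open MonoidSum +-monoid using (sum-cong-≋; sum-replicate-zero)
  open CommutativeSemigroupProperties *-commutativeSemigroup using (interchange)
  open SetoidReasoning setoid

  -- The multiple by `x` of a standard basis vector, stated for any semiring because three occur: ℤ
  -- for coefficients of linear forms, ℚ for the dual basis, and polynomials for a generator as a
  -- member of its own ideal.
  unit : Fin n → Carrier → Vector Carrier n
  unit j x k = if does (k Fin.≟ j) then x else 0#

  sum-unit : (j : Fin n) (x : Carrier) (a : Vector Carrier n) → sum (λ k → unit j x k * a k) ≈ x * a j
  sum-unit {suc n} zero x a = begin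
    x * a zero + sum (λ k → 0# * a (suc k))  ≈⟨ +-congˡ (sum-cong-≋ {n} λ k → zeroˡ (a (suc k))) ⟩
    x * a zero + sum (λ (_ : Fin n) → 0#)    ≈⟨ +-congˡ (sum-replicate-zero n) ⟩
    x * a zero + 0#                          ≈⟨ +-identityʳ _ ⟩
    x * a zero                               ∎
  sum-unit (suc j) x a = begin
    0# * a zero + sum (λ k → unit j x k * a (suc k))  ≈⟨ +-cong (zeroˡ _) (sum-unit j x (a ∘ suc)) ⟩
    0# + x * a (suc j)                                ≈⟨ +-identityˡ _ ⟩
    x * a (suc j)                                     ∎

  evalᴹ : Vector Carrier l → Mon l → Carrier
  evalᴹ s []      = 1#
  evalᴹ s (n ∷ a) = s zero ^ n * evalᴹ (s ∘ suc) a

  evalᴹ-1 : (s : Vector Carrier l) → evalᴹ s 1ᴹ ≈ 1#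
  evalᴹ-1 {zero}  s = refl
  evalᴹ-1 {suc l} s = trans (*-identityˡ _) (evalᴹ-1 (s ∘ suc))

  evalᴹ-* : (s : Vector Carrier l) (a b : Mon l) → evalᴹ s (a *ᴹ b) ≈ evalᴹ s a * evalᴹ s b
  evalᴹ-* s []      []      = sym (*-identityˡ 1#)
  evalᴹ-* s (m ∷ a) (n ∷ b) = begin
    s zero ^ (m ℕ.+ n) * evalᴹ (s ∘ suc) (a *ᴹ b)
      ≈⟨ *-cong (^-homo-* (s zero) m n) (evalᴹ-* (s ∘ suc) a b) ⟩
    (s zero ^ m * s zero ^ n) * (evalᴹ (s ∘ suc) a * evalᴹ (s ∘ suc) b)
      ≈⟨ interchange _ _ _ _ ⟩
    (s zero ^ m * evalᴹ (s ∘ suc) a) * (s zero ^ n * evalᴹ (s ∘ suc) b)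
      ∎

  evalᴹ-var : (s : Vector Carrier l) (k : Fin l) → evalᴹ s (var k) ≈ s k
  evalᴹ-var s zero    = begin
    s zero * 1# * evalᴹ (s ∘ suc) 1ᴹ  ≈⟨ *-cong (*-identityʳ _) (evalᴹ-1 (s ∘ suc)) ⟩
    s zero * 1#                       ≈⟨ *-identityʳ _ ⟩
    s zero                            ∎
  evalᴹ-var s (suc k) = trans (*-identityˡ _) (evalᴹ-var (s ∘ suc) k)

  -- Congruence modulo α, without subtraction because R is only a semiring.
  module Modulo (α : Carrier) where

    infix 4 _∼_
    _∼_ : Carrier → Carrier → Set _
    x ∼ y = ∃[ q ] x ≈ q * α + y

    ∼-reflexive : ∀ {x y} → x ≈ y → x ∼ y
    ∼-reflexive x≈y = 0# , trans x≈y (sym (trans (+-congʳ (zeroˡ α)) (+-identityˡ _)))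

    ∼-trans : ∀ {x y z} → x ∼ y → y ∼ z → x ∼ z
    ∼-trans {x} {y} {z} (q , x≈) (r , y≈) = q + r , (begin
      x                    ≈⟨ x≈ ⟩
      q * α + y            ≈⟨ +-congˡ y≈ ⟩
      q * α + (r * α + z)  ≈⟨ +-assoc _ _ _ ⟨
      q * α + r * α + z    ≈⟨ +-congʳ (distribʳ α q r) ⟨
      (q + r) * α + z      ∎)

    *-congˡ-∼ : ∀ z {x y} → x ∼ y → z * x ∼ z * y
    *-congˡ-∼ z {x} {y} (q , x≈) = z * q , (begin
      z * x                ≈⟨ *-congˡ x≈ ⟩
      z * (q * α + y)      ≈⟨ distribˡ z _ y ⟩
      z * (q * α) + z * y  ≈⟨ +-congʳ (*-assoc z q α) ⟨
      z * q * α + z * y    ∎)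

    *-cong-∼ : ∀ {x y u v} → x ∼ y → u ∼ v → x * u ∼ y * v
    *-cong-∼ {x} {y} {u} {v} x∼y u∼v = ∼-trans (*-congˡ-∼ x u∼v)
      (∼-trans (∼-reflexive (*-comm x v)) (∼-trans (*-congˡ-∼ v x∼y) (∼-reflexive (*-comm v y))))

    +-congˡ-∼ : ∀ z {x y} → x ∼ y → z + x ∼ z + y
    +-congˡ-∼ z {x} {y} (q , x≈) = q , (begin
      z + x              ≈⟨ +-congˡ x≈ ⟩
      z + (q * α + y)    ≈⟨ +-assoc z _ y ⟨
      z + q * α + y      ≈⟨ +-congʳ (+-comm z _) ⟩
      q * α + z + y      ≈⟨ +-assoc _ z y ⟩
      q * α + (z + y)    ∎)

    +-cong-∼ : ∀ {x y u v} → x ∼ y → u ∼ v → x + u ∼ y + v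
    +-cong-∼ {x} {y} {u} {v} x∼y u∼v = ∼-trans (+-congˡ-∼ x u∼v)
      (∼-trans (∼-reflexive (+-comm x v)) (∼-trans (+-congˡ-∼ v x∼y) (∼-reflexive (+-comm v y))))

open import Data.Integer.Base using (_+_; _*_; _-_; -_)
open import Data.Integer.Divisibility.Signed using (_∣_)
open import Relation.Binary.PropositionalEquality hiding ([_])

-- Pairing polynomials with functions

k∣0 : ∀ {k} → k ∣ 0ℤ
k∣0 {k} = divides 0ℤ (sym (ℤ.*-zeroˡ k))

⟪_,_⟫ : Poly l → (Mon l → ℤ) → ℤ
⟪ []          , F ⟫ = 0ℤ
⟪ (c , a) ∷ f , F ⟫ = c * F a + ⟪ f , F ⟫

δ : Mon l → Mon l → ℤ
δ m a = if does (a ≟ᴹ m) then 1ℤ else 0ℤ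

δ-refl : (m : Mon l) → δ m m ≡ 1ℤ
δ-refl m rewrite dec-true (m ≟ᴹ m) refl = refl

δ-≢ : {m a : Mon l} → a ≢ m → δ m a ≡ 0ℤ
δ-≢ {m = m} {a} a≢m rewrite dec-false (a ≟ᴹ m) a≢m = refl

coeff-pairing : (f : Poly l) (m : Mon l) → coeff f m ≡ ⟪ f , δ m ⟫
coeff-pairing []            m = refl
coeff-pairing ((c , a) ∷ f) m = cong₂ _+_ head (coeff-pairing f m)
  where
  head : (if does (a ≟ᴹ m) then c else 0ℤ) ≡ c * δ m a
  head with does (a ≟ᴹ m)
  ... | true  = sym (ℤ.*-identityʳ c)
  ... | false = sym (ℤ.*-zeroʳ c)

pairing-cong : (f : Poly l) {F G : Mon l → ℤ} → (∀ a → F a ≡ G a) → ⟪ f , F ⟫ ≡ ⟪ f , G ⟫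
pairing-cong []            F≗G = refl
pairing-cong ((c , a) ∷ f) F≗G = cong₂ _+_ (cong (c *_) (F≗G a)) (pairing-cong f F≗G)

pairing-zero : (f : Poly l) → ⟪ f , (λ _ → 0ℤ) ⟫ ≡ 0ℤ
pairing-zero []            = refl
pairing-zero ((c , _) ∷ f) = cong₂ _+_ (ℤ.*-zeroʳ c) (pairing-zero f)

pairing-+ : (f : Poly l) (F G : Mon l → ℤ) → ⟪ f , (λ a → F a + G a) ⟫ ≡ ⟪ f , F ⟫ + ⟪ f , G ⟫
pairing-+ []            F G = refl
pairing-+ ((c , a) ∷ f) F G =
  trans (cong (c * (F a + G a) +_) (pairing-+ f F G)) (rearrange c (F a) (G a) ⟪ f , F ⟫ ⟪ f , G ⟫)
  where
  rearrange : ∀ c x y s t → c * (x + y) + (s + t) ≡ (c * x + s) + (c * y + t)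
  rearrange = solve-∀

pairing-*ˡ : (f : Poly l) (k : ℤ) (F : Mon l → ℤ) → ⟪ f , (λ a → k * F a) ⟫ ≡ k * ⟪ f , F ⟫
pairing-*ˡ []            k F = sym (ℤ.*-zeroʳ k)
pairing-*ˡ ((c , a) ∷ f) k F =
  trans (cong (c * (k * F a) +_) (pairing-*ˡ f k F)) (rearrange c k (F a) ⟪ f , F ⟫)
  where
  rearrange : ∀ c k x s → c * (k * x) + k * s ≡ k * (c * x + s)
  rearrange = solve-∀

pairing-++ : (f g : Poly l) (F : Mon l → ℤ) → ⟪ f ++ g , F ⟫ ≡ ⟪ f , F ⟫ + ⟪ g , F ⟫
pairing-++ []            g F = sym (ℤ.+-identityˡ _)
pairing-++ ((c , a) ∷ f) g F =
  trans (cong (c * F a +_) (pairing-++ f g F)) (sym (ℤ.+-assoc (c * F a) _ _))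

-- Fubini for two finite sums. It gives commutativity of the product and multiplicativity of
-- substitutions.
pairing-swap : ∀ {l′} (f : Poly l) (g : Poly l′) (F : Mon l → Mon l′ → ℤ) →
  ⟪ f , (λ a → ⟪ g , F a ⟫) ⟫ ≡ ⟪ g , (λ b → ⟪ f , (λ a → F a b) ⟫) ⟫
pairing-swap []            g F = sym (pairing-zero g)
pairing-swap ((c , a) ∷ f) g F = begin
  c * ⟪ g , F a ⟫ + ⟪ f , (λ x → ⟪ g , F x ⟫) ⟫
    ≡⟨ cong₂ _+_ (sym (pairing-*ˡ g c (F a))) (pairing-swap f g F) ⟩
  ⟪ g , (λ b → c * F a b) ⟫ + ⟪ g , (λ b → ⟪ f , (λ x → F x b) ⟫) ⟫
    ≡⟨ pairing-+ g _ _ ⟨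
  ⟪ g , (λ b → c * F a b + ⟪ f , (λ x → F x b) ⟫) ⟫
    ∎
  where open ≡-Reasoning

-- The product is a convolution, so testing it against `F` is an iterated pairing. Ring laws thereby
-- become laws of power products under nested pairings, with no normal form for polynomials.
pairing-* : (f g : Poly l) (F : Mon l → ℤ) →
  ⟪ f *ᴾ g , F ⟫ ≡ ⟪ f , (λ a → ⟪ g , (λ b → F (a *ᴹ b)) ⟫) ⟫
pairing-* []            g F = refl
pairing-* ((c , a) ∷ f) g F =
  trans (pairing-++ (List.map _ g) (f *ᴾ g) F) (cong₂ _+_ (row g) (pairing-* f g F))
  where
  row : ∀ g → ⟪ List.map (λ { (d , b) → c * d , a *ᴹ b }) g , F ⟫ ≡ c * ⟪ g , (λ b → F (a *ᴹ b)) ⟫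
  row []            = sym (ℤ.*-zeroʳ c)
  row ((d , b) ∷ g) = trans (cong (c * d * F (a *ᴹ b) +_) (row g)) (rearrange c d (F (a *ᴹ b)) _)
    where
    rearrange : ∀ c d x s → c * d * x + c * s ≡ c * (d * x + s)
    rearrange = solve-∀

remove : Mon l → Poly l → Poly l
remove a = filter λ t → ¬? (proj₂ t ≟ᴹ a)

-- Power products may repeat in a formal sum; collecting all terms at `a` at once makes their total
-- weight the actual coefficient.
pairing-remove : (a : Mon l) (f : Poly l) (F : Mon l → ℤ) →
  ⟪ f , F ⟫ ≡ coeff f a * F a + ⟪ remove a f , F ⟫
pairing-remove a []            F = refl
pairing-remove a ((c , b) ∷ f) F with b ≟ᴹ a
... | yes refl = trans (cong (c * F b +_) (pairing-remove b f F))
  (rearrange c (F b) (coeff f b) ⟪ remove b f , F ⟫)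
  where
  rearrange : ∀ c x s t → c * x + (s * x + t) ≡ (c + s) * x + t
  rearrange = solve-∀
... | no  _    = trans (cong (c * F b +_) (pairing-remove a f F))
  (rearrange c (F b) (F a) (coeff f a) ⟪ remove a f , F ⟫)
  where
  rearrange : ∀ c x y s t → c * x + (s * y + t) ≡ (0ℤ + s) * y + (c * x + t)
  rearrange = solve-∀

remove-head : (c : ℤ) (a : Mon l) (f : Poly l) → remove a ((c , a) ∷ f) ≡ remove a f
remove-head c a f with a ≟ᴹ a
... | yes _   = refl
... | no  a≢a = contradiction refl a≢a

coeff-remove-≡ : (a : Mon l) (f : Poly l) → coeff (remove a f) a ≡ 0ℤ
coeff-remove-≡ a []            = refl
coeff-remove-≡ a ((c , b) ∷ f) with b ≟ᴹ a in eq
... | yes _ = coeff-remove-≡ a f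
... | no  _ rewrite eq = trans (ℤ.+-identityˡ _) (coeff-remove-≡ a f)

coeff-remove-≢ : {a x : Mon l} (f : Poly l) → x ≢ a → coeff (remove a f) x ≡ coeff f x
coeff-remove-≢         []            x≢a = refl
coeff-remove-≢ {a = a} {x} ((c , b) ∷ f) x≢a with b ≟ᴹ a
... | no  _    = cong ((if does (b ≟ᴹ x) then c else 0ℤ) +_) (coeff-remove-≢ f x≢a)
... | yes refl rewrite dec-false (a ≟ᴹ x) (x≢a ∘ sym) =
  trans (coeff-remove-≢ f x≢a) (sym (ℤ.+-identityˡ _))

-- By induction on the number of terms, removing all those which share the power
-- product of the first one.
pairing-divisible : ∀ {k} (f : Poly l) (F : Mon l → ℤ) →
  (∀ a → k ∣ coeff f a * F a) → k ∣ ⟪ f , F ⟫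
pairing-divisible {l = l} {k} f F = go (length f) f ℕ.≤-refl
  where
  go : ∀ n (f : Poly l) → length f ℕ.≤ n → (∀ a → k ∣ coeff f a * F a) → k ∣ ⟪ f , F ⟫
  go n       []            _     _ = k∣0
  go (suc n) ((c , a) ∷ f) |f|≤n k∣ =
    subst (k ∣_) (sym (pairing-remove a ((c , a) ∷ f) F))
      (ℤ.∣m∣n⇒∣m+n (k∣ a) (go n (remove a ((c , a) ∷ f)) shorter k∣′))
    where
    shorter : length (remove a ((c , a) ∷ f)) ℕ.≤ n
    shorter rewrite remove-head c a f = ℕ.≤-trans (List.length-filter _ f) (s≤s⁻¹ |f|≤n)

    k∣′ : ∀ x → k ∣ coeff (remove a ((c , a) ∷ f)) x * F x
    k∣′ x with x ≟ᴹ a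
    ... | yes refl rewrite coeff-remove-≡ x ((c , x) ∷ f) = k∣0
    ... | no  x≢a  rewrite coeff-remove-≢ ((c , a) ∷ f) x≢a = k∣ x

-- Polynomials modulo p

*ᴹ-assoc : (a b c : Mon l) → a *ᴹ b *ᴹ c ≡ a *ᴹ (b *ᴹ c)
*ᴹ-assoc = Vec.zipWith-assoc ℕ.+-assoc

*ᴹ-comm : (a b : Mon l) → a *ᴹ b ≡ b *ᴹ a
*ᴹ-comm = Vec.zipWith-comm ℕ.+-comm

*ᴹ-identityˡ : (a : Mon l) → 1ᴹ *ᴹ a ≡ a
*ᴹ-identityˡ = Vec.zipWith-identityˡ ℕ.+-identityˡ

scale : ℤ → Poly l → Poly l
scale k = List.map λ { (c , a) → k * c , a }

pairing-scale : (k : ℤ) (f : Poly l) (F : Mon l → ℤ) → ⟪ scale k f , F ⟫ ≡ k * ⟪ f , F ⟫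
pairing-scale k []            F = sym (ℤ.*-zeroʳ k)
pairing-scale k ((c , a) ∷ f) F =
  trans (cong (k * c * F a +_) (pairing-scale k f F)) (rearrange k c (F a) ⟪ f , F ⟫)
  where
  rearrange : ∀ k c x s → k * c * x + k * s ≡ k * (c * x + s)
  rearrange = solve-∀

pairing-constant-* : (k : ℤ) (f : Poly l) (F : Mon l → ℤ) → ⟪ [ k , 1ᴹ ] *ᴾ f , F ⟫ ≡ k * ⟪ f , F ⟫
pairing-constant-* k f F = begin
  ⟪ [ k , 1ᴹ ] *ᴾ f , F ⟫                  ≡⟨ pairing-* [ k , 1ᴹ ] f F ⟩
  k * ⟪ f , (λ b → F (1ᴹ *ᴹ b)) ⟫ + 0ℤ     ≡⟨ ℤ.+-identityʳ _ ⟩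
  k * ⟪ f , (λ b → F (1ᴹ *ᴹ b)) ⟫
    ≡⟨ cong (k *_) (pairing-cong f λ b → cong F (*ᴹ-identityˡ b)) ⟩
  k * ⟪ f , F ⟫                            ∎
  where open ≡-Reasoning

pairing-difference : (f g : Poly l) (F : Mon l → ℤ) → ⟪ f ++ scale (- 1ℤ) g , F ⟫ ≡ ⟪ f , F ⟫ - ⟪ g , F ⟫
pairing-difference f g F = begin
  ⟪ f ++ scale (- 1ℤ) g , F ⟫          ≡⟨ pairing-++ f (scale (- 1ℤ) g) F ⟩
  ⟪ f , F ⟫ + ⟪ scale (- 1ℤ) g , F ⟫   ≡⟨ cong (⟪ f , F ⟫ +_) (pairing-scale (- 1ℤ) g F) ⟩
  ⟪ f , F ⟫ + - 1ℤ * ⟪ g , F ⟫         ≡⟨ cong (⟪ f , F ⟫ +_) (ℤ.-1*i≡-i ⟪ g , F ⟫) ⟩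
  ⟪ f , F ⟫ - ⟪ g , F ⟫                ∎
  where open ≡-Reasoning

module Mod (p : ℕ) where

  infix 4 _≈ₚ_ _≋_

  -- A record rather than an abbreviation, so that `x` and `y` can be inferred from the type; they
  -- could not be recovered from the difference `x - y`.
  record _≈ₚ_ (x y : ℤ) : Set where
    constructor congruent
    field difference : ℤ.+ p ∣ x - y
  open _≈ₚ_ public

  ≈ₚ-reflexive : ∀ {x y} → x ≡ y → x ≈ₚ y
  ≈ₚ-reflexive {x} refl = congruent (subst (ℤ.+ p ∣_) (sym (ℤ.+-inverseʳ x)) k∣0)

  ≈ₚ-refl : ∀ {x} → x ≈ₚ x
  ≈ₚ-refl = ≈ₚ-reflexive refl

  ≈ₚ-sym : ∀ {x y} → x ≈ₚ y → y ≈ₚ x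
  ≈ₚ-sym {x} {y} (congruent d) = congruent (subst (ℤ.+ p ∣_) (flip x y) (ℤ.∣m⇒∣-m d))
    where
    flip : ∀ x y → - (x - y) ≡ y - x
    flip = solve-∀

  ≈ₚ-trans : ∀ {x y z} → x ≈ₚ y → y ≈ₚ z → x ≈ₚ z
  ≈ₚ-trans {x} {y} {z} (congruent d) (congruent e) =
    congruent (subst (ℤ.+ p ∣_) (telescope x y z) (ℤ.∣m∣n⇒∣m+n d e))
    where
    telescope : ∀ x y z → (x - y) + (y - z) ≡ x - z
    telescope = solve-∀

  ≈ₚ-setoid : Setoid 0ℓ 0ℓ
  ≈ₚ-setoid = record
    { _≈_           = _≈ₚ_
    ; isEquivalence = record { refl = ≈ₚ-refl ; sym = ≈ₚ-sym ; trans = ≈ₚ-trans }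
    }

  +-congₚ : ∀ {x y u v} → x ≈ₚ y → u ≈ₚ v → x + u ≈ₚ y + v
  +-congₚ {x} {y} {u} {v} (congruent d) (congruent e) =
    congruent (subst (ℤ.+ p ∣_) (rearrange x y u v) (ℤ.∣m∣n⇒∣m+n d e))
    where
    rearrange : ∀ x y u v → (x - y) + (u - v) ≡ x + u - (y + v)
    rearrange = solve-∀

  *-congˡₚ : ∀ k {x y} → x ≈ₚ y → k * x ≈ₚ k * y
  *-congˡₚ k {x} {y} (congruent d) =
    congruent (subst (ℤ.+ p ∣_) (rearrange k x y) (ℤ.∣n⇒∣m*n k d))
    where
    rearrange : ∀ k x y → k * (x - y) ≡ k * x - k * y
    rearrange = solve-∀

  ∣⇒≈0 : ∀ {x} → ℤ.+ p ∣ x → x ≈ₚ 0ℤ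
  ∣⇒≈0 {x} p∣x = congruent (subst (ℤ.+ p ∣_) (sym (ℤ.+-identityʳ x)) p∣x)

  ≈0⇒∣ : ∀ {x} → x ≈ₚ 0ℤ → ℤ.+ p ∣ x
  ≈0⇒∣ {x} (congruent d) = subst (ℤ.+ p ∣_) (ℤ.+-identityʳ x) d

  pairing-congₚ : (f : Poly l) {F G : Mon l → ℤ} → (∀ a → F a ≈ₚ G a) → ⟪ f , F ⟫ ≈ₚ ⟪ f , G ⟫
  pairing-congₚ []            F≈G = ≈ₚ-refl
  pairing-congₚ ((c , a) ∷ f) F≈G = +-congₚ (*-congˡₚ c (F≈G a)) (pairing-congₚ f F≈G)

  -- Testing against every `F`, and not only against `δ m`, allows a factor to be replaced when `F`
  -- is itself given by a pairing, as happens in products and substitutions.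
  record _≋_ (f g : Poly l) : Set where
    constructor tested
    field test : ∀ F → ⟪ f , F ⟫ ≈ₚ ⟪ g , F ⟫
  open _≋_ public

  exactly : {f g : Poly l} → (∀ F → ⟪ f , F ⟫ ≡ ⟪ g , F ⟫) → f ≋ g
  exactly eq = tested (≈ₚ-reflexive ∘ eq)

  coeff-cong : {f g : Poly l} → f ≋ g → ∀ m → coeff f m ≈ₚ coeff g m
  coeff-cong {f = f} {g} f≋g m =
    subst₂ _≈ₚ_ (sym (coeff-pairing f m)) (sym (coeff-pairing g m)) (test f≋g (δ m))

  -- All coefficients of f - g are multiples of p, so `pairing-divisible` applies to that
  -- difference. Together with `coeff-cong` this identifies `_≋_` with congruence of coefficients.
  coeff-injective : {f g : Poly l} → (∀ m → coeff f m ≈ₚ coeff g m) → f ≋ g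
  coeff-injective {f = f} {g} f≈g = tested λ F → congruent
    (subst (ℤ.+ p ∣_) (pairing-difference f g F) (pairing-divisible (f ++ scale (- 1ℤ) g) F (λ a →
      ℤ.∣m⇒∣m*n (F a) (subst (ℤ.+ p ∣_) (coeff-difference a) (difference (f≈g a))))))
    where
    coeff-difference : ∀ a → coeff f a - coeff g a ≡ coeff (f ++ scale (- 1ℤ) g) a
    coeff-difference a
      rewrite coeff-pairing f a | coeff-pairing g a | coeff-pairing (f ++ scale (- 1ℤ) g) a =
      sym (pairing-difference f g (δ a))

  -- The algebraic laws hold exactly over ℤ; the modulus enters only through the equivalence and
  -- congruence rules. The case p = 0 is ℤ[x] itself.
  ≋-commutativeSemiring : ℕ → CommutativeSemiring 0ℓ 0ℓ
  ≋-commutativeSemiring l = record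
    { Carrier               = Poly l
    ; _≈_                   = _≋_
    ; _+_                   = _++_
    ; _*_                   = _*ᴾ_
    ; 0#                    = []
    ; 1#                    = [ 1ℤ , 1ᴹ ]
    ; isCommutativeSemiring = IsCommutativeSemiringˡ.isCommutativeSemiring record
      { +-isCommutativeMonoid = IsCommutativeMonoidˡ.isCommutativeMonoid record
        { isSemigroup = record
          { isMagma = record { isEquivalence = ≋-isEquivalence ; ∙-cong = ++-cong }
          ; assoc   = λ f g h → ≋-reflexive (List.++-assoc f g h)
          }
        ; identityˡ   = λ _ → ≋-refl
        ; comm        = λ f g → exactly λ F →
            trans (pairing-++ f g F) (trans (ℤ.+-comm ⟪ f , F ⟫ _) (sym (pairing-++ g f F)))
        }
      ; *-isCommutativeMonoid = IsCommutativeMonoidˡ.isCommutativeMonoid record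
        { isSemigroup = record
          { isMagma = record { isEquivalence = ≋-isEquivalence ; ∙-cong = *-cong }
          ; assoc   = *-assoc
          }
        ; identityˡ   = *-identityˡ
        ; comm        = *-comm
        }
      ; distribʳ              = *-distribʳ
      ; zeroˡ                 = λ _ → ≋-refl
      }
    }
    where
    ≋-refl : ∀ {f : Poly l} → f ≋ f
    ≋-refl = tested λ _ → ≈ₚ-refl

    ≋-reflexive : {f g : Poly l} → f ≡ g → f ≋ g
    ≋-reflexive refl = ≋-refl

    ≋-isEquivalence : IsEquivalence _≋_
    ≋-isEquivalence = record
      { refl  = ≋-refl
      ; sym   = λ f≋g → tested (≈ₚ-sym ∘ test f≋g)
      ; trans = λ f≋g g≋h → tested λ F → ≈ₚ-trans (test f≋g F) (test g≋h F)
      }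

    ++-cong : {f f′ g g′ : Poly l} → f ≋ f′ → g ≋ g′ → f ++ g ≋ f′ ++ g′
    ++-cong {f} {f′} {g} {g′} f≋f′ g≋g′ = tested λ F →
      subst₂ _≈ₚ_ (sym (pairing-++ f g F)) (sym (pairing-++ f′ g′ F))
        (+-congₚ (test f≋f′ F) (test g≋g′ F))

    *-cong : {f f′ g g′ : Poly l} → f ≋ f′ → g ≋ g′ → f *ᴾ g ≋ f′ *ᴾ g′
    *-cong {f} {f′} {g} {g′} f≋f′ g≋g′ = tested λ F →
      subst₂ _≈ₚ_ (sym (pairing-* f g F)) (sym (pairing-* f′ g′ F))
        -- First f is replaced under the function that pairs with g, then g is replaced inside it.
        (≈ₚ-trans (test f≋f′ _) (pairing-congₚ f′ λ _ → test g≋g′ _))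

    *-assoc : (f g h : Poly l) → f *ᴾ g *ᴾ h ≋ f *ᴾ (g *ᴾ h)
    *-assoc f g h = exactly λ F → begin
      ⟪ f *ᴾ g *ᴾ h , F ⟫
        ≡⟨ trans (pairing-* (f *ᴾ g) h F) (pairing-* f g _) ⟩
      ⟪ f , (λ a → ⟪ g , (λ b → ⟪ h , (λ c → F (a *ᴹ b *ᴹ c)) ⟫) ⟫) ⟫
        ≡⟨ pairing-cong f (λ a → pairing-cong g λ b → pairing-cong h λ c → cong F (*ᴹ-assoc a b c)) ⟩
      ⟪ f , (λ a → ⟪ g , (λ b → ⟪ h , (λ c → F (a *ᴹ (b *ᴹ c))) ⟫) ⟫) ⟫
        ≡⟨ trans (pairing-* f (g *ᴾ h) F) (pairing-cong f λ a → pairing-* g h _) ⟨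
      ⟪ f *ᴾ (g *ᴾ h) , F ⟫
        ∎
      where open ≡-Reasoning

    *-comm : (f g : Poly l) → f *ᴾ g ≋ g *ᴾ f
    *-comm f g = exactly λ F → begin
      ⟪ f *ᴾ g , F ⟫                               ≡⟨ pairing-* f g F ⟩
      ⟪ f , (λ a → ⟪ g , (λ b → F (a *ᴹ b)) ⟫) ⟫   ≡⟨ pairing-swap f g _ ⟩
      ⟪ g , (λ b → ⟪ f , (λ a → F (a *ᴹ b)) ⟫) ⟫
        ≡⟨ pairing-cong g (λ b → pairing-cong f λ a → cong F (*ᴹ-comm a b)) ⟩
      ⟪ g , (λ b → ⟪ f , (λ a → F (b *ᴹ a)) ⟫) ⟫   ≡⟨ pairing-* g f F ⟨
      ⟪ g *ᴾ f , F ⟫                               ∎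
      where open ≡-Reasoning

    *-identityˡ : (f : Poly l) → [ 1ℤ , 1ᴹ ] *ᴾ f ≋ f
    *-identityˡ f = exactly λ F → trans (pairing-constant-* 1ℤ f F) (ℤ.*-identityˡ ⟪ f , F ⟫)

    *-distribʳ : (f g h : Poly l) → (g ++ h) *ᴾ f ≋ g *ᴾ f ++ h *ᴾ f
    *-distribʳ f g h = exactly λ F → begin
      ⟪ (g ++ h) *ᴾ f , F ⟫                ≡⟨ trans (pairing-* (g ++ h) f F) (pairing-++ g h _) ⟩
      ⟪ g , _ ⟫ + ⟪ h , _ ⟫                ≡⟨ cong₂ _+_ (pairing-* g f F) (pairing-* h f F) ⟨
      ⟪ g *ᴾ f , F ⟫ + ⟪ h *ᴾ f , F ⟫      ≡⟨ pairing-++ (g *ᴾ f) (h *ᴾ f) F ⟨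
      ⟪ g *ᴾ f ++ h *ᴾ f , F ⟫             ∎
      where open ≡-Reasoning

-- Leading power products

*ᴹ-cancelˡ : (a : Mon l) {b c : Mon l} → a *ᴹ b ≡ a *ᴹ c → b ≡ c
*ᴹ-cancelˡ []      {[]}    {[]}    _  = refl
*ᴹ-cancelˡ (i ∷ a) {j ∷ b} {k ∷ c} eq =
  cong₂ _∷_ (ℕ.+-cancelˡ-≡ i j k (Vec.∷-injectiveˡ eq)) (*ᴹ-cancelˡ a (Vec.∷-injectiveʳ eq))

coeff-support : (f : Poly l) {m : Mon l} → coeff f m ≢ 0ℤ → m ∈ˡ List.map proj₂ f
coeff-support []            c≢0 = contradiction refl c≢0
coeff-support ((c , a) ∷ f) {m} c≢0 with a ≟ᴹ m
... | yes refl = here refl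
... | no  _    = there (coeff-support f (c≢0 ∘ trans (ℤ.+-identityˡ _)))

module _ (σ : TermOrder l) where

  open TermOrder σ
  open IsTotalOrder isTotalOrder using (antisym)
  open Extrema totalOrder using (max; argmax-sel; xs≤max)

  -- The predicate is kept general because two supports occur: that of nonzero integer coefficients,
  -- and the smaller one of coefficients nonzero modulo p.
  IsLargest : Pred (Mon l) 0ℓ → Pred (Mon l) 0ℓ
  IsLargest P m = P m × (∀ {x} → P x → x ≼ m)

  -- If the maximum is the default `1ᴹ`, then x lies both below and above it, so the default is x
  -- and belongs to the list anyway.
  max-∈ : {x : Mon l} {ms : List (Mon l)} → x ∈ˡ ms → max 1ᴹ ms ∈ˡ ms
  max-∈ {x} {ms} x∈ms with argmax-sel (λ m → m) 1ᴹ ms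
  ... | inj₂ max∈ms = max∈ms
  ... | inj₁ max≡1  = subst (_∈ˡ ms) (antisym x≼max max≼x) x∈ms
    where
    x≼max = All.lookup (xs≤max 1ᴹ ms) x∈ms
    max≼x = subst (_≼ x) (sym max≡1) (1-minimum x)

  max-isLargest : {P : Pred (Mon l) 0ℓ} (P? : Decidable P) (ms : List (Mon l)) →
    (∀ {m} → P m → m ∈ˡ ms) → ∀ {x} → P x → IsLargest P (max 1ᴹ (filter P? ms))
  max-isLargest P? ms P⊆ms Px =
      proj₂ (∈-filter⁻ P? {xs = ms} (max-∈ (∈-filter⁺ P? (P⊆ms Px) Px)))
    , λ Py → All.lookup (xs≤max 1ᴹ _) (∈-filter⁺ P? (P⊆ms Py) Py)

  lpp-isLargest : (f : Poly l) {x : Mon l} → coeff f x ≢ 0ℤ → IsLargest (λ m → coeff f m ≢ 0ℤ) (lpp σ f)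
  lpp-isLargest f = max-isLargest (λ m → ¬? (coeff f m ℤ.≟ 0ℤ)) (List.map proj₂ f) (coeff-support f)

  -- If xy = ab, then ab = xy ≼ xb ≼ ab, so xb = ab by antisymmetry, and cancelling b gives x = a.
  *ᴹ-≢ : {x y a b : Mon l} → x ≼ a → x ≢ a → y ≼ b → x *ᴹ y ≢ a *ᴹ b
  *ᴹ-≢ {x} {y} {a} {b} x≼a x≢a y≼b xy≡ab =
    x≢a (*ᴹ-cancelˡ b (trans (*ᴹ-comm b x) (trans (antisym (*-mono b x≼a) ab≼xb) (*ᴹ-comm a b))))
    where
    ab≼xb : a *ᴹ b ≼ x *ᴹ b
    ab≼xb = subst₂ _≼_ (trans (*ᴹ-comm y x) xy≡ab) (*ᴹ-comm b x) (*-mono x y≼b)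

  -- Leading terms modulo p, and polynomials over 𝔽ₚ as a domain.

  module ModPrime (p : ℕ) (p-prime : Prime p) where

    open Mod p

    prime-split : ∀ {x y} → x * y ≈ₚ 0ℤ → x ≈ₚ 0ℤ ⊎ y ≈ₚ 0ℤ
    prime-split {x} {y} xy≈0
      with euclidsLemma ℤ.∣ x ∣ ℤ.∣ y ∣ p-prime (subst (p ℕᵈ.∣_) (ℤ.abs-* x y) (ℤ.∣⇒∣ᵤ (≈0⇒∣ xy≈0)))
    ... | inj₁ p∣x = inj₁ (∣⇒≈0 (ℤ.∣ᵤ⇒∣ p∣x))
    ... | inj₂ p∣y = inj₂ (∣⇒≈0 (ℤ.∣ᵤ⇒∣ p∣y))

    _≈0? : ∀ x → Dec (x ≈ₚ 0ℤ)
    x ≈0? with ℤ.+ p ℤ.∣? x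
    ... | yes p∣x = yes (∣⇒≈0 p∣x)
    ... | no  p∤x = no (p∤x ∘ ≈0⇒∣)

    NonZeroCoeff : Poly l → Pred (Mon l) 0ℓ
    NonZeroCoeff f m = ¬ coeff f m ≈ₚ 0ℤ

    nonZeroCoeff? : (f : Poly l) → Decidable (NonZeroCoeff f)
    nonZeroCoeff? f m = ¬? (coeff f m ≈0?)

    -- The power product found leads the reduction of f modulo p; it can be smaller than `lpp σ f`,
    -- whose coefficient may be divisible by p.
    zero-or-leading : (f : Poly l) → f ≋ [] ⊎ ∃[ m ] IsLargest (NonZeroCoeff f) m
    zero-or-leading f with Any.any? (nonZeroCoeff? f) (List.map proj₂ f)
    ... | yes any = inj₂
      (_ , max-isLargest (nonZeroCoeff? f) (List.map proj₂ f) nonZero-support (proj₂ (Any.satisfied any)))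
      where
      nonZero-support : ∀ {m} → NonZeroCoeff f m → m ∈ˡ List.map proj₂ f
      nonZero-support c≉0 = coeff-support f (c≉0 ∘ ≈ₚ-reflexive)
    ... | no ¬any = inj₁ (coeff-injective λ m → decidable-stable (coeff f m ≈0?) λ c≉0 →
          ¬any (lose (coeff-support f (c≉0 ∘ ≈ₚ-reflexive)) c≉0))

    -- Once the terms at `a` are split off, every remaining coefficient times its value of `F` is a
    -- multiple of p. The alternative is chosen separately at each x, since `F x` may be known to
    -- vanish only where the coefficient does not.
    pairing-single : (f : Poly l) (F : Mon l → ℤ) (a : Mon l) →
      (∀ {x} → x ≢ a → coeff f x ≈ₚ 0ℤ ⊎ F x ≈ₚ 0ℤ) → ⟪ f , F ⟫ ≈ₚ coeff f a * F a
    pairing-single f F a vanishes = begin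
      ⟪ f , F ⟫                               ≡⟨ pairing-remove a f F ⟩
      coeff f a * F a + ⟪ remove a f , F ⟫
        ≈⟨ +-congₚ (≈ₚ-refl {coeff f a * F a}) (∣⇒≈0 (pairing-divisible (remove a f) F p∣)) ⟩
      coeff f a * F a + 0ℤ                    ≡⟨ ℤ.+-identityʳ _ ⟩
      coeff f a * F a                         ∎
      where
      open SetoidReasoning ≈ₚ-setoid

      p∣ : ∀ x → ℤ.+ p ∣ coeff (remove a f) x * F x
      p∣ x with x ≟ᴹ a
      ... | yes refl = ℤ.∣m⇒∣m*n (F x) (subst (ℤ.+ p ∣_) (sym (coeff-remove-≡ x f)) k∣0)
      ... | no  x≢a rewrite coeff-remove-≢ f x≢a with vanishes x≢a
      ...   | inj₁ c≈0 = ℤ.∣m⇒∣m*n (F x) (≈0⇒∣ c≈0)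
      ...   | inj₂ F≈0 = ℤ.∣n⇒∣m*n (coeff f x) (≈0⇒∣ F≈0)

    -- Among the products xy with both coefficients nonzero modulo p, only x = a, y = b yields ab:
    -- for x ≠ a by `*ᴹ-≢`, and for x = a by cancellation.
    coeff-*-leading : (f g : Poly l) {a b : Mon l} →
      IsLargest (NonZeroCoeff f) a → IsLargest (NonZeroCoeff g) b →
      coeff (f *ᴾ g) (a *ᴹ b) ≈ₚ coeff f a * coeff g b
    coeff-*-leading f g {a} {b} (_ , x≼a) (_ , y≼b) = begin
      coeff (f *ᴾ g) (a *ᴹ b)        ≡⟨ coeff-pairing (f *ᴾ g) _ ⟩
      ⟪ f *ᴾ g , δ (a *ᴹ b) ⟫        ≡⟨ pairing-* f g _ ⟩
      ⟪ f , (λ x → ⟪ g , (λ y → δ (a *ᴹ b) (x *ᴹ y)) ⟫) ⟫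
        ≈⟨ pairing-single f _ a vanishes ⟩
      coeff f a * ⟪ g , (λ y → δ (a *ᴹ b) (a *ᴹ y)) ⟫
        ≡⟨ cong (coeff f a *_) (trans (pairing-cong g cancel-δ) (sym (coeff-pairing g b))) ⟩
      coeff f a * coeff g b          ∎
      where
      open SetoidReasoning ≈ₚ-setoid

      cancel-δ : ∀ y → δ (a *ᴹ b) (a *ᴹ y) ≡ δ b y
      cancel-δ y with y ≟ᴹ b
      ... | yes refl = δ-refl (a *ᴹ y)
      ... | no  y≢b  = δ-≢ (y≢b ∘ *ᴹ-cancelˡ a)

      vanishes : ∀ {x} → x ≢ a →
        coeff f x ≈ₚ 0ℤ ⊎ ⟪ g , (λ y → δ (a *ᴹ b) (x *ᴹ y)) ⟫ ≈ₚ 0ℤ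
      vanishes {x} x≢a with coeff f x ≈0?
      ... | yes c≈0 = inj₁ c≈0
      ... | no  c≉0 = inj₂ (∣⇒≈0 (pairing-divisible g _ p∣))
        where
        p∣ : ∀ y → ℤ.+ p ∣ coeff g y * δ (a *ᴹ b) (x *ᴹ y)
        p∣ y with coeff g y ≈0?
        ... | yes d≈0 = ℤ.∣m⇒∣m*n _ (≈0⇒∣ d≈0)
        ... | no  d≉0 = ℤ.∣n⇒∣m*n (coeff g y)
          (subst (ℤ.+ p ∣_) (sym (δ-≢ (*ᴹ-≢ (x≼a c≉0) x≢a (y≼b d≉0)))) k∣0)

    -- Were both factors nonzero, the product of their leading coefficients modulo p would be a
    -- vanishing coefficient of fg, against Euclid's lemma.
    zero-product : (f g : Poly l) → f *ᴾ g ≋ [] → f ≋ [] ⊎ g ≋ []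
    zero-product f g fg≋0 = split (zero-or-leading f) (zero-or-leading g)
      where
      split : f ≋ [] ⊎ ∃[ a ] IsLargest (NonZeroCoeff f) a →
              g ≋ [] ⊎ ∃[ b ] IsLargest (NonZeroCoeff g) b → f ≋ [] ⊎ g ≋ []
      split (inj₁ f≋0)             _                      = inj₁ f≋0
      split (inj₂ _)               (inj₁ g≋0)             = inj₂ g≋0
      split (inj₂ (a , leading-f)) (inj₂ (b , leading-g)) =
        Sum.[ (λ c≈0 → contradiction c≈0 (proj₁ leading-f))
        , (λ d≈0 → contradiction d≈0 (proj₁ leading-g))
        ] (prime-split {coeff f a} {coeff g b}
            (≈ₚ-trans (≈ₚ-sym (coeff-*-leading f g leading-f leading-g)) (coeff-cong fg≋0 (a *ᴹ b))))

-- Linear forms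

open SemiringSum ℤ.+-*-semiring using
  (sum; sum-cong-≗; sum-replicate-zero; *-distribˡ-sum; *-distribʳ-sum; ∑-distrib-+)

-- The variables generate the monoid of power products. The first exponent is split off as (n ∷ 1)(0
-- ∷ a), and the recursion runs with the predicate restricted to vectors beginning with 0.
var-*-induction : (P : Mon l → Set) → P 1ᴹ → (∀ k → P (var k)) →
  (∀ {a b} → P a → P b → P (a *ᴹ b)) → ∀ a → P a
var-*-induction P P1 Pvar P* []      = P1
var-*-induction P P1 Pvar P* (n ∷ a) =
  subst P (cong₂ _∷_ (ℕ.+-identityʳ n) (*ᴹ-identityˡ a)) (P* (power n) (tail a))
  where
  power : ∀ n → P (n ∷ 1ᴹ)
  power zero    = P1
  power (suc n) = subst (P ∘ (suc n ∷_)) (*ᴹ-identityˡ 1ᴹ) (P* (Pvar zero) (power n))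

  tail : ∀ a → P (0 ∷ a)
  tail = var-*-induction (P ∘ (0 ∷_)) P1 (Pvar ∘ suc) P*

var-*-≢1 : (k : Fin l) {x : Mon l} → x *ᴹ var k ≢ 1ᴹ
var-*-≢1 zero    {n ∷ x} eq with () ← ℕ.m+n≡0⇒n≡0 n (Vec.∷-injectiveˡ eq)
var-*-≢1 (suc k) {n ∷ x} eq = var-*-≢1 k (Vec.∷-injectiveʳ eq)

*ᴹ-var⁻¹ : (k j : Fin l) {x : Mon l} → x *ᴹ var k ≡ var j → x ≡ 1ᴹ × k ≡ j
*ᴹ-var⁻¹ zero    zero    {n ∷ x} eq =
  cong₂ _∷_ (ℕ.+-cancelʳ-≡ 1 n 0 (Vec.∷-injectiveˡ eq))
    (trans (sym (*ᴹ-identityˡ x)) (trans (*ᴹ-comm 1ᴹ x) (Vec.∷-injectiveʳ eq))) , refl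
*ᴹ-var⁻¹ zero    (suc j) {n ∷ x} eq with () ← ℕ.m+n≡0⇒n≡0 n (Vec.∷-injectiveˡ eq)
*ᴹ-var⁻¹ (suc k) zero    {n ∷ x} eq = contradiction (Vec.∷-injectiveʳ eq) (var-*-≢1 k)
*ᴹ-var⁻¹ (suc k) (suc j) {n ∷ x} eq with refl , refl ← *ᴹ-var⁻¹ k j (Vec.∷-injectiveʳ eq) =
  cong (_∷ 1ᴹ) (ℕ.m+n≡0⇒m≡0 n (Vec.∷-injectiveˡ eq)) , refl

pairing-toPoly : (a : LinForm l) (F : Mon l → ℤ) → ⟪ toPoly a , F ⟫ ≡ sum λ k → a k * F (var k)
pairing-toPoly {l} a F = tabulated a var
  where
  tabulated : ∀ {n} (a : Fin n → ℤ) (v : Fin n → Mon l) →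
    ⟪ List.tabulate (λ k → a k , v k) , F ⟫ ≡ sum λ k → a k * F (v k)
  tabulated {zero}  a v = refl
  tabulated {suc n} a v = cong (a zero * F (v zero) +_) (tabulated (a ∘ suc) (v ∘ suc))

unitℤ : Fin l → ℤ → LinForm l
unitℤ = unit ℤ.+-*-commutativeSemiring

sum-unitℤ : (j : Fin l) (a : LinForm l) (x : ℤ) → sum (λ k → a k * unitℤ j x k) ≡ a j * x
sum-unitℤ j a x = begin
  sum (λ k → a k * unitℤ j x k)  ≡⟨ sum-cong-≗ (λ k → ℤ.*-comm (a k) _) ⟩
  sum (λ k → unitℤ j x k * a k)  ≡⟨ sum-unit ℤ.+-*-commutativeSemiring j x a ⟩
  x * a j                        ≡⟨ ℤ.*-comm x (a j) ⟩
  a j * x                        ∎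
  where open ≡-Reasoning

-- A multiple of x_k is x_j only when the cofactor is 1 and k = j.
δ-var : (j k : Fin l) (x : Mon l) → δ (var j) (x *ᴹ var k) ≡ unitℤ j (δ 1ᴹ x) k
δ-var j k x with k Fin.≟ j | x ≟ᴹ 1ᴹ
... | yes refl | yes refl = trans (cong (δ (var k)) (*ᴹ-identityˡ (var k))) (δ-refl (var k))
... | yes refl | no  x≢1  = δ-≢ {m = var j} {x *ᴹ var k} (x≢1 ∘ proj₁ ∘ *ᴹ-var⁻¹ k j)
... | no  k≢j  | _        = δ-≢ {m = var j} {x *ᴹ var k} (k≢j ∘ proj₂ ∘ *ᴹ-var⁻¹ k j)

-- All terms of a linear form have degree one, so only the constant term of q reaches the
-- coefficient of x_j. This turns divisibility and ideal membership of polynomials into linear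
-- algebra over ℤ.
coeff-*-toPoly : (q : Poly l) (a : LinForm l) (j : Fin l) →
  coeff (q *ᴾ toPoly a) (var j) ≡ coeff q 1ᴹ * a j
coeff-*-toPoly q a j = begin
  coeff (q *ᴾ toPoly a) (var j)
    ≡⟨ trans (coeff-pairing (q *ᴾ toPoly a) (var j)) (pairing-* q (toPoly a) _) ⟩
  ⟪ q , (λ x → ⟪ toPoly a , (λ y → δ (var j) (x *ᴹ y)) ⟫) ⟫
    ≡⟨ pairing-cong q (λ x → trans (pairing-toPoly a _) (sum-cong-≗ λ k → cong (a k *_) (δ-var j k x))) ⟩
  ⟪ q , (λ x → sum λ k → a k * unitℤ j (δ 1ᴹ x) k) ⟫
    ≡⟨ pairing-cong q (λ x → sum-unitℤ j a (δ 1ᴹ x)) ⟩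
  ⟪ q , (λ x → a j * δ 1ᴹ x) ⟫
    ≡⟨ pairing-*ˡ q (a j) (δ 1ᴹ) ⟩
  a j * ⟪ q , δ 1ᴹ ⟫
    ≡⟨ cong (a j *_) (coeff-pairing q 1ᴹ) ⟨
  a j * coeff q 1ᴹ
    ≡⟨ ℤ.*-comm (a j) _ ⟩
  coeff q 1ᴹ * a j
    ∎
  where open ≡-Reasoning

coeff-*-toPoly-1 : (q : Poly l) (a : LinForm l) → coeff (q *ᴾ toPoly a) 1ᴹ ≡ 0ℤ
coeff-*-toPoly-1 {l} q a = begin
  coeff (q *ᴾ toPoly a) 1ᴹ
    ≡⟨ trans (coeff-pairing (q *ᴾ toPoly a) 1ᴹ) (pairing-* q (toPoly a) _) ⟩
  ⟪ q , (λ x → ⟪ toPoly a , (λ y → δ 1ᴹ (x *ᴹ y)) ⟫) ⟫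
    ≡⟨ pairing-cong q (λ x → trans (pairing-toPoly a _)
         (sum-cong-≗ λ k →
           trans (cong (a k *_) (δ-≢ {m = 1ᴹ} {x *ᴹ var k} (var-*-≢1 k))) (ℤ.*-zeroʳ (a k)))) ⟩
  ⟪ q , (λ x → sum {l} λ k → 0ℤ) ⟫
    ≡⟨ pairing-cong q (λ x → sum-replicate-zero l) ⟩
  ⟪ q , (λ x → 0ℤ) ⟫
    ≡⟨ pairing-zero q ⟩
  0ℤ
    ∎
  where open ≡-Reasoning

coeff-toPoly : (a : LinForm l) (j : Fin l) → coeff (toPoly a) (var j) ≡ a j
coeff-toPoly {l} a j = begin
  coeff (toPoly a) (var j)                 ≡⟨ coeff-pairing (toPoly a) (var j) ⟩
  ⟪ toPoly a , δ (var j) ⟫                 ≡⟨ pairing-toPoly a _ ⟩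
  sum (λ k → a k * δ (var j) (var k))
    ≡⟨ sum-cong-≗ (λ k → cong (a k *_)
         (trans (cong (δ (var j)) (sym (*ᴹ-identityˡ (var k)))) (δ-var j k (1ᴹ {l})))) ⟩
  sum (λ k → a k * unitℤ j (δ 1ᴹ (1ᴹ {l})) k)  ≡⟨ sum-unitℤ j a (δ 1ᴹ (1ᴹ {l})) ⟩
  a j * δ 1ᴹ (1ᴹ {l})                          ≡⟨ cong (a j *_) (δ-refl (1ᴹ {l})) ⟩
  a j * 1ℤ                                 ≡⟨ ℤ.*-identityʳ (a j) ⟩
  a j                                      ∎
  where open ≡-Reasoning

-- Inverses modulo p and substitution homomorphisms.

module _ (p : ℕ) where

  open Mod p

  -- Bézout's identity is applied to the natural numbers `∣ x ∣` and p. The factor `s` with |x| = s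
  -- x accounts for the sign of x, and the two computations are for the two sign patterns of the
  -- identity.
  inverse : Prime p → ∀ {x} → ¬ x ≈ₚ 0ℤ → ∃[ y ] x * y ≈ₚ 1ℤ
  inverse p-prime {x} x≉0 with ℤ.m∣∣m∣ {x} | Coprimality.coprime-Bézout coprime
    where
    coprime : Coprimality.Coprime ℤ.∣ x ∣ p
    coprime (d∣x , d∣p) with prime⇒irreducible p-prime d∣p
    ... | inj₁ d≡1  = d≡1
    ... | inj₂ refl = contradiction (∣⇒≈0 (ℤ.∣ᵤ⇒∣ d∣x)) x≉0
  ... | divides s |x|≡sx | GCD.Bézout.+- m n 1+np≡m|x| = s * ℤ.+ m , congruent (divides (ℤ.+ n) (begin
    x * (s * ℤ.+ m) - 1ℤ       ≡⟨ cong (_- 1ℤ) (rearrange x s (ℤ.+ m)) ⟩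
    ℤ.+ m * (s * x) - 1ℤ       ≡⟨ cong (λ t → ℤ.+ m * t - 1ℤ) |x|≡sx ⟨
    ℤ.+ m * ℤ.+ ℤ.∣ x ∣ - 1ℤ   ≡⟨ cong (_- 1ℤ) (ℤ.pos-* m ℤ.∣ x ∣) ⟨
    ℤ.+ (m ℕ.* ℤ.∣ x ∣) - 1ℤ   ≡⟨ cong (λ t → ℤ.+ t - 1ℤ) 1+np≡m|x| ⟨
    1ℤ + ℤ.+ (n ℕ.* p) - 1ℤ    ≡⟨ cancel (ℤ.+ (n ℕ.* p)) ⟩
    ℤ.+ (n ℕ.* p)              ≡⟨ ℤ.pos-* n p ⟩
    ℤ.+ n * ℤ.+ p              ∎))
    where
    open ≡-Reasoning

    rearrange : ∀ x s m → x * (s * m) ≡ m * (s * x)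
    rearrange = solve-∀

    cancel : ∀ t → 1ℤ + t - 1ℤ ≡ t
    cancel = solve-∀
  ... | divides s |x|≡sx | GCD.Bézout.-+ m n 1+m|x|≡np = - (s * ℤ.+ m) , congruent (divides (- ℤ.+ n) (begin
    x * - (s * ℤ.+ m) - 1ℤ           ≡⟨ rearrange x s (ℤ.+ m) ⟩
    - (1ℤ + ℤ.+ m * (s * x))         ≡⟨ cong (λ t → - (1ℤ + ℤ.+ m * t)) |x|≡sx ⟨
    - (1ℤ + ℤ.+ m * ℤ.+ ℤ.∣ x ∣)     ≡⟨ cong (λ t → - (1ℤ + t)) (ℤ.pos-* m ℤ.∣ x ∣) ⟨
    - ℤ.+ (1 ℕ.+ m ℕ.* ℤ.∣ x ∣)      ≡⟨ cong (λ t → - ℤ.+ t) 1+m|x|≡np ⟩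
    - ℤ.+ (n ℕ.* p)                  ≡⟨ cong -_ (ℤ.pos-* n p) ⟩
    - (ℤ.+ n * ℤ.+ p)                ≡⟨ ℤ.neg-distribˡ-* (ℤ.+ n) (ℤ.+ p) ⟩
    - ℤ.+ n * ℤ.+ p                  ∎))
    where
    open ≡-Reasoning

    rearrange : ∀ x s m → x * - (s * m) - 1ℤ ≡ - (1ℤ + m * (s * x))
    rearrange = solve-∀

  module Substitution (s : Fin l → Poly l) where

    Φ : Mon l → Poly l
    Φ = evalᴹ (≋-commutativeSemiring l) s

    φ : Poly l → Poly l
    φ []            = []
    φ ((c , a) ∷ f) = scale c (Φ a) ++ φ f

    -- φ acts on representatives, yet its pairings depend on f only through pairings of f. Hence it
    -- respects `_≋_` at once.
    pairing-φ : (f : Poly l) (F : Mon l → ℤ) → ⟪ φ f , F ⟫ ≡ ⟪ f , (λ a → ⟪ Φ a , F ⟫) ⟫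
    pairing-φ []            F = refl
    pairing-φ ((c , a) ∷ f) F =
      trans (pairing-++ (scale c (Φ a)) (φ f) F) (cong₂ _+_ (pairing-scale c (Φ a) F) (pairing-φ f F))

    φ-cong : {f g : Poly l} → f ≋ g → φ f ≋ φ g
    φ-cong {f} {g} f≋g = tested λ F →
      subst₂ _≈ₚ_ (sym (pairing-φ f F)) (sym (pairing-φ g F)) (test f≋g _)

    φ-* : (f g : Poly l) → φ (f *ᴾ g) ≋ φ f *ᴾ φ g
    φ-* f g = tested λ F → begin
      ⟪ φ (f *ᴾ g) , F ⟫
        ≡⟨ trans (pairing-φ (f *ᴾ g) F) (pairing-* f g _) ⟩
      ⟪ f , (λ a → ⟪ g , (λ b → ⟪ Φ (a *ᴹ b) , F ⟫) ⟫) ⟫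
        ≈⟨ pairing-congₚ f (λ a → pairing-congₚ g λ b → test (evalᴹ-* (≋-commutativeSemiring l) s a b) F) ⟩
      ⟪ f , (λ a → ⟪ g , (λ b → ⟪ Φ a *ᴾ Φ b , F ⟫) ⟫) ⟫
        -- The swap brings `Φ a` outside the pairing with g, so that the sum over g inside can be
        -- recognised as a pairing with `φ g`.
        ≡⟨ pairing-cong f (λ a →
             trans (pairing-cong g λ b → pairing-* (Φ a) (Φ b) F) (pairing-swap g (Φ a) _)) ⟩
      ⟪ f , (λ a → ⟪ Φ a , (λ x → ⟪ g , (λ b → ⟪ Φ b , (λ y → F (x *ᴹ y)) ⟫) ⟫) ⟫) ⟫
        ≡⟨ pairing-cong f (λ a → pairing-cong (Φ a) λ x → pairing-φ g _) ⟨
      ⟪ f , (λ a → ⟪ Φ a , (λ x → ⟪ φ g , (λ y → F (x *ᴹ y)) ⟫) ⟫) ⟫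
        ≡⟨ trans (pairing-* (φ f) (φ g) F) (pairing-φ f _) ⟨
      ⟪ φ f *ᴾ φ g , F ⟫
        ∎
      where open SetoidReasoning ≈ₚ-setoid

-- Linear forms are prime modulo p

module Linear (p : ℕ) {l : ℕ} (a : LinForm l) (j : Fin l) (c : ℤ) where

  open Mod p

  α : Poly l
  α = toPoly a

  -- The substitution x_j ↦ x_j − c α sends α to (1 − a_j c) α.
  s : Fin l → Poly l
  s k = [ 1ℤ , var k ] ++ scale (unitℤ j (- c) k) α

  open Substitution p s
  open CommutativeSemiring (≋-commutativeSemiring l) using () renaming
    (trans to ≋-trans; sym to ≋-sym; refl to ≋-refl; reflexive to ≋-reflexive; +-cong to ++-cong)
  open Modulo (≋-commutativeSemiring l) α

  scale-* : (k : ℤ) (f : Poly l) → [ k , 1ᴹ ] *ᴾ f ≋ scale k f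
  scale-* k f = exactly λ F → trans (pairing-constant-* k f F) (sym (pairing-scale k f F))

  -- Each x_k differs from its image by a multiple of α, and congruence modulo α is multiplicative.
  monomial∼Φ : ∀ m → [ 1ℤ , m ] ∼ Φ m
  monomial∼Φ = var-*-induction (λ m → [ 1ℤ , m ] ∼ Φ m)
    (∼-reflexive (≋-sym (evalᴹ-1 (≋-commutativeSemiring l) s)))
    variable∼
    (λ {m} {n} m∼ n∼ →
      ∼-trans (*-cong-∼ m∼ n∼) (∼-reflexive (≋-sym (evalᴹ-* (≋-commutativeSemiring l) s m n))))
    where
    variable∼ : ∀ k → [ 1ℤ , var k ] ∼ Φ (var k)
    -- Since s k = x_k + d α, the multiple of α to be added back has the constant cofactor -d.
    variable∼ k = ∼-trans ([ - d , 1ᴹ ] , ≋-trans x≋ (++-cong (≋-sym (scale-* (- d) α)) ≋-refl))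
      (∼-reflexive (≋-sym (evalᴹ-var (≋-commutativeSemiring l) s k)))
      where
      d : ℤ
      d = unitℤ j (- c) k

      rearrange : ∀ d x y → x ≡ - d * y + (x + d * y)
      rearrange = solve-∀

      x≋ : [ 1ℤ , var k ] ≋ scale (- d) α ++ s k
      x≋ = exactly λ F → sym (begin
        ⟪ scale (- d) α ++ s k , F ⟫
          ≡⟨ trans (pairing-++ (scale (- d) α) (s k) F)
               (cong₂ _+_ (pairing-scale (- d) α F)
                 (trans (pairing-++ [ 1ℤ , var k ] (scale d α) F)
                   (cong (⟪ [ 1ℤ , var k ] , F ⟫ +_) (pairing-scale d α F)))) ⟩
        - d * ⟪ α , F ⟫ + (⟪ [ 1ℤ , var k ] , F ⟫ + d * ⟪ α , F ⟫)
          ≡⟨ rearrange d ⟪ [ 1ℤ , var k ] , F ⟫ ⟪ α , F ⟫ ⟨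
        ⟪ [ 1ℤ , var k ] , F ⟫
          ∎)
        where open ≡-Reasoning

  ∼φ : ∀ f → f ∼ φ f
  ∼φ []            = ∼-reflexive ≋-refl
  ∼φ ((k , m) ∷ f) = +-cong-∼ term∼ (∼φ f)
    where
    term≋ : [ k , m ] ≋ [ k , 1ᴹ ] *ᴾ [ 1ℤ , m ]
    term≋ = ≋-trans (≋-reflexive (cong (λ c → [ c , m ]) (sym (ℤ.*-identityʳ k))))
      (≋-sym (scale-* k [ 1ℤ , m ]))

    term∼ : [ k , m ] ∼ scale k (Φ m)
    term∼ = ∼-trans (∼-reflexive term≋)
      (∼-trans (*-congˡ-∼ [ k , 1ᴹ ] (monomial∼Φ m)) (∼-reflexive (scale-* k (Φ m))))

  φα≋0 : a j * c ≈ₚ 1ℤ → φ α ≋ []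
  φα≋0 ac≈1 = tested λ F → begin
    ⟪ φ α , F ⟫
      ≡⟨ trans (pairing-φ α F) (pairing-toPoly a _) ⟩
    sum (λ k → a k * ⟪ Φ (var k) , F ⟫)
      ≈⟨ sum-congₚ (λ k → *-congˡₚ (a k) (test (evalᴹ-var (≋-commutativeSemiring l) s k) F)) ⟩
    sum (λ k → a k * ⟪ s k , F ⟫)
      ≡⟨ sum-cong-≗ (term F) ⟩
    sum (λ k → a k * F (var k) + a k * unitℤ j (- c) k * ⟪ α , F ⟫)
      ≡⟨ ∑-distrib-+ {l} (λ k → a k * F (var k)) (λ k → a k * unitℤ j (- c) k * ⟪ α , F ⟫) ⟩
    sum (λ k → a k * F (var k)) + sum (λ k → a k * unitℤ j (- c) k * ⟪ α , F ⟫)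
      ≡⟨ cong₂ _+_ (pairing-toPoly a F)
           (trans (cong (_* ⟪ α , F ⟫) (sym (sum-unitℤ j a (- c))))
             (*-distribʳ-sum ⟪ α , F ⟫ (λ k → a k * unitℤ j (- c) k))) ⟨
    ⟪ α , F ⟫ + a j * - c * ⟪ α , F ⟫
      ≡⟨ rearrange (a j) c ⟪ α , F ⟫ ⟩
    ⟪ α , F ⟫ + - ⟪ α , F ⟫ * (a j * c)
      ≈⟨ +-congₚ (≈ₚ-refl {⟪ α , F ⟫}) (*-congˡₚ (- ⟪ α , F ⟫) ac≈1) ⟩
    ⟪ α , F ⟫ + - ⟪ α , F ⟫ * 1ℤ
      ≡⟨ cancel ⟪ α , F ⟫ ⟩
    0ℤ
      ∎
    where
    open SetoidReasoning ≈ₚ-setoid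

    sum-congₚ : ∀ {n} {x y : Fin n → ℤ} → (∀ k → x k ≈ₚ y k) → sum x ≈ₚ sum y
    sum-congₚ {zero}  x≈y = ≈ₚ-refl
    sum-congₚ {suc n} x≈y = +-congₚ (x≈y zero) (sum-congₚ (x≈y ∘ suc))

    rearrange : ∀ x c t → t + x * - c * t ≡ t + - t * (x * c)
    rearrange = solve-∀

    cancel : ∀ t → t + - t * 1ℤ ≡ 0ℤ
    cancel = solve-∀

    expand : ∀ x v d t → x * (1ℤ * v + 0ℤ + d * t) ≡ x * v + x * d * t
    expand = solve-∀

    term : ∀ F k → a k * ⟪ s k , F ⟫ ≡ a k * F (var k) + a k * unitℤ j (- c) k * ⟪ α , F ⟫
    term F k =
      trans (cong (a k *_) (trans (pairing-++ [ 1ℤ , var k ] (scale d α) F)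
              (cong (⟪ [ 1ℤ , var k ] , F ⟫ +_) (pairing-scale d α F))))
        (expand (a k) (F (var k)) d ⟪ α , F ⟫)
      where
      d : ℤ
      d = unitℤ j (- c) k

module _ (σ : TermOrder l) (p : ℕ) (p-prime : Prime p) where

  open Mod p
  open ModPrime σ p p-prime
  open CommutativeSemiring (≋-commutativeSemiring l) using (rawSemiring) renaming
    (trans to ≋-trans; sym to ≋-sym; refl to ≋-refl; +-cong to ++-cong; *-congˡ to *-congˡ-≋;
     +-identityʳ to ++-identityʳ; zeroʳ to zeroʳ-≋)
  open SemiringDefs rawSemiring using (mkPrime) renaming (Prime to PrimeElement; _∣_ to _∣≋_; _∤_ to _∤≋_)

  0≉1 : ¬ 0ℤ ≈ₚ 1ℤ
  0≉1 0≈1 = ℕ.nonTrivial⇒≢1 {{prime⇒nonTrivial p-prime}} (ℕᵈ.∣1⇒≡1 (ℤ.∣⇒∣ᵤ (≈0⇒∣ (≈ₚ-sym 0≈1))))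

  toPoly-≉0 : (a : LinForm l) {j : Fin l} → ¬ a j ≈ₚ 0ℤ → ¬ toPoly a ≋ []
  toPoly-≉0 a {j} aⱼ≉0 α≋0 =
    aⱼ≉0 (subst (_≈ₚ 0ℤ) (coeff-toPoly a j) (coeff-cong α≋0 (var j)))

  -- With `c` inverse to a_j, α divides f exactly when `φ f` vanishes: φ is multiplicative and kills
  -- α, and conversely f is congruent to `φ f` modulo α. Primality thus becomes the absence of zero
  -- divisors, applied to `φ f` and `φ g`.
  toPoly-prime : (a : LinForm l) {j : Fin l} → ¬ a j ≈ₚ 0ℤ → PrimeElement (toPoly a)
  toPoly-prime a {j} aⱼ≉0 = mkPrime (toPoly-≉0 a aⱼ≉0) α∤1 α-split
    where
    c = proj₁ (inverse p p-prime aⱼ≉0)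
    open Linear p a j c
    open Substitution p s using (φ; φ-cong; φ-*)

    φα : φ α ≋ []
    φα = φα≋0 (proj₂ (inverse p p-prime aⱼ≉0))

    α∤1 : α ∤≋ [ 1ℤ , 1ᴹ ]
    -- Constant terms are compared: that of qα is 0.
    α∤1 (q , qα≋1) = 0≉1 (subst₂ _≈ₚ_ (coeff-*-toPoly-1 q a) coeff-1 (coeff-cong qα≋1 1ᴹ))
      where
      coeff-1 : coeff [ 1ℤ , 1ᴹ ] (1ᴹ {l}) ≡ 1ℤ
      coeff-1 = trans (coeff-pairing [ 1ℤ , 1ᴹ ] (1ᴹ {l})) (cong (λ t → 1ℤ * t + 0ℤ) (δ-refl (1ᴹ {l})))

    φ≋0⇒∣ : ∀ f → φ f ≋ [] → α ∣≋ f
    φ≋0⇒∣ f φf≋0 with q , f≋ ← ∼φ f =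
      q , ≋-sym (≋-trans f≋ (≋-trans (++-cong (≋-refl {q *ᴾ α}) φf≋0) (++-identityʳ (q *ᴾ α))))

    ∣⇒φ≋0 : ∀ f → α ∣≋ f → φ f ≋ []
    ∣⇒φ≋0 f (q , qα≋f) = ≋-trans (φ-cong (≋-sym qα≋f))
      (≋-trans (φ-* q α) (≋-trans (*-congˡ-≋ {φ q} φα) (zeroʳ-≋ (φ q))))

    α-split : ∀ {f g} → α ∣≋ f *ᴾ g → α ∣≋ f Sum.⊎ α ∣≋ g
    α-split {f} {g} α∣fg = Sum.map (φ≋0⇒∣ f) (φ≋0⇒∣ g)
      (zero-product (φ f) (φ g) (≋-trans (≋-sym (φ-* f g)) (∣⇒φ≋0 (f *ᴾ g) α∣fg)))

  -- The difference g - h, formed with `scale (- 1ℤ)`, is annihilated by f, and `zero-product`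
  -- applies.
  *-cancelˡ-≋ : (f : Poly l) {g h : Poly l} → ¬ f ≋ [] → f *ᴾ g ≋ f *ᴾ h → g ≋ h
  *-cancelˡ-≋ f {g} {h} f≉0 fg≋fh =
    Sum.[ (λ f≋0 → contradiction f≋0 f≉0) , equal ] (zero-product f g-h f*g-h≋0)
    where
    g-h : Poly l
    g-h = g ++ scale (- 1ℤ) h

    equal : g-h ≋ [] → g ≋ h
    equal g-h≋0 = tested λ F → congruent
      (≈0⇒∣ (subst (_≈ₚ 0ℤ) (pairing-difference g h F) (test g-h≋0 F)))

    f*g-h≋0 : f *ᴾ g-h ≋ []
    f*g-h≋0 = tested λ F → begin
      ⟪ f *ᴾ g-h , F ⟫
        ≡⟨ trans (pairing-* f g-h F) (pairing-cong f λ a → pairing-++ g (scale (- 1ℤ) h) _) ⟩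
      ⟪ f , (λ a → ⟪ g , (λ b → F (a *ᴹ b)) ⟫ + ⟪ scale (- 1ℤ) h , (λ b → F (a *ᴹ b)) ⟫) ⟫
        ≡⟨ trans (pairing-+ f _ _) (cong₂ _+_ (sym (pairing-* f g F))
             (trans (pairing-cong f λ a → pairing-scale (- 1ℤ) h _) (pairing-*ˡ f (- 1ℤ) _))) ⟩
      ⟪ f *ᴾ g , F ⟫ + - 1ℤ * ⟪ f , (λ a → ⟪ h , (λ b → F (a *ᴹ b)) ⟫) ⟫
        ≡⟨ cong (⟪ f *ᴾ g , F ⟫ +_) (trans (ℤ.-1*i≡-i _) (cong -_ (sym (pairing-* f h F)))) ⟩
      ⟪ f *ᴾ g , F ⟫ - ⟪ f *ᴾ h , F ⟫
        ≈⟨ ∣⇒≈0 (difference (fg≋fh .test F)) ⟩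
      0ℤ
        ∎
      where open SetoidReasoning ≈ₚ-setoid

-- Two independent linear forms over ℚ

toℚ : ℤ → ℚ
toℚ z = z / 1

toℚ-* : ∀ x y → toℚ (x ℤ.* y) ≡ toℚ x ℚ.* toℚ y
toℚ-* x y = ℚ.toℚᵘ-injective (begin
  ℚ.toℚᵘ (toℚ (x ℤ.* y))                  ≈⟨ ℚ.toℚᵘ-fromℚᵘ (mkℚᵘ (x ℤ.* y) 0) ⟩
  mkℚᵘ x 0 ℚᵘ.* mkℚᵘ y 0
    ≈⟨ ℚᵘ.*-cong (ℚ.toℚᵘ-fromℚᵘ (mkℚᵘ x 0)) (ℚ.toℚᵘ-fromℚᵘ (mkℚᵘ y 0)) ⟨
  ℚ.toℚᵘ (toℚ x) ℚᵘ.* ℚ.toℚᵘ (toℚ y)      ≈⟨ ℚ.toℚᵘ-homo-* (toℚ x) (toℚ y) ⟨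
  ℚ.toℚᵘ (toℚ x ℚ.* toℚ y)                ∎)
  where open SetoidReasoning ℚᵘ.≃-setoid

toℚ-injective : ∀ {x y} → toℚ x ≡ toℚ y → x ≡ y
toℚ-injective {x} {y} eq with ℚ.fromℚᵘ-injective {mkℚᵘ x 0} {mkℚᵘ y 0} eq
... | ℚᵘ.*≡* x*1≡y*1 = trans (sym (ℤ.*-identityʳ x)) (trans x*1≡y*1 (ℤ.*-identityʳ y))

ℚ-commutativeSemiring : CommutativeSemiring 0ℓ 0ℓ
ℚ-commutativeSemiring = CommutativeRing.commutativeSemiring ℚ.+-*-commutativeRing

open SemiringSum (CommutativeSemiring.semiring ℚ-commutativeSemiring) using ()
  renaming (sum to ∑ℚ; sum-cong-≗ to ∑ℚ-cong)

infix 8 _·_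
_·_ : Vector ℚ l → Vector ℚ l → ℚ
A · v = ∑ℚ λ k → A k ℚ.* v k

·-+ : (A u v : Vector ℚ l) → A · (λ k → u k ℚ.+ v k) ≡ A · u ℚ.+ A · v
·-+ {zero}  A u v = refl
·-+ {suc l} A u v = trans (cong (A zero ℚ.* (u zero ℚ.+ v zero) ℚ.+_) (·-+ (A ∘ suc) (u ∘ suc) (v ∘ suc)))
  (solve 5 (λ a x y s t → a :* (x :+ y) :+ (s :+ t) := (a :* x :+ s) :+ (a :* y :+ t)) refl
    (A zero) (u zero) (v zero) _ _)
  where open +-*-Solver

·-*ˡ : (A : Vector ℚ l) (c : ℚ) (v : Vector ℚ l) → A · (λ k → c ℚ.* v k) ≡ c ℚ.* A · v
·-*ˡ {zero}  A c v = sym (ℚ.*-zeroʳ c)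
·-*ˡ {suc l} A c v = trans (cong (A zero ℚ.* (c ℚ.* v zero) ℚ.+_) (·-*ˡ (A ∘ suc) c (v ∘ suc)))
  (solve 4 (λ a c x s → a :* (c :* x) :+ c :* s := c :* (a :* x :+ s)) refl (A zero) c (v zero) _)
  where open +-*-Solver

·-linComb : (A : Vector ℚ l) (c : Vector ℚ 2) (b : Vector (Vector ℚ l) 2) →
  A · linComb c b ≡ c 0F ℚ.* A · b 0F ℚ.+ c 1F ℚ.* A · b 1F
·-linComb A c b = begin
  A · linComb c b
    ≡⟨ ∑ℚ-cong (λ k → cong (λ t → A k ℚ.* (c 0F ℚ.* b 0F k ℚ.+ t)) (ℚ.+-identityʳ (c 1F ℚ.* b 1F k))) ⟩
  A · (λ k → c 0F ℚ.* b 0F k ℚ.+ c 1F ℚ.* b 1F k)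
    ≡⟨ ·-+ A _ _ ⟩
  A · (λ k → c 0F ℚ.* b 0F k) ℚ.+ A · (λ k → c 1F ℚ.* b 1F k)
    ≡⟨ cong₂ ℚ._+_ (·-*ˡ A (c 0F) (b 0F)) (·-*ˡ A (c 1F) (b 1F)) ⟩
  c 0F ℚ.* A · b 0F ℚ.+ c 1F ℚ.* A · b 1F
    ∎
  where open ≡-Reasoning

·-- : (A u v : Vector ℚ l) → A · (λ k → u k ℚ.- v k) ≡ A · u ℚ.- A · v
·-- {zero}  A u v = refl
·-- {suc l} A u v = trans (cong (A zero ℚ.* (u zero ℚ.- v zero) ℚ.+_) (·-- (A ∘ suc) (u ∘ suc) (v ∘ suc)))
  (solve 5 (λ a x y s t → a :* (x :- y) :+ (s :- t) := (a :* x :+ s) :- (a :* y :+ t)) refl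
    (A zero) (u zero) (v zero) _ _)
  where open +-*-Solver

unitℚ : Fin l → ℚ → Vector ℚ l
unitℚ = unit ℚ-commutativeSemiring

·-unit : (A : Vector ℚ l) (i : Fin l) (x : ℚ) → A · unitℚ i x ≡ x ℚ.* A i
·-unit A i x = trans (∑ℚ-cong λ k → ℚ.*-comm (A k) _) (sum-unit ℚ-commutativeSemiring i x A)

module _ (A B : Vector ℚ l) {i j : Fin l} (minor≢0 : A i ℚ.* B j ≢ A j ℚ.* B i) where

  open +-*-Solver

  private
    D : ℚ
    D = A i ℚ.* B j ℚ.- A j ℚ.* B i

    D≢0 : D ≢ 0ℚ
    D≢0 D≡0 = minor≢0 (trans
      (solve 2 (λ x y → x := (x :- y) :+ y) refl (A i ℚ.* B j) (A j ℚ.* B i))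
      (trans (cong (ℚ._+ A j ℚ.* B i) D≡0) (ℚ.+-identityˡ _)))

    instance
      D-nonZero : ℚ.NonZero D
      D-nonZero = ℚ.≢-nonZero D≢0

    ·-units : ∀ C x y → C · (λ k → unitℚ i x k ℚ.+ unitℚ j y k) ≡ x ℚ.* C i ℚ.+ y ℚ.* C j
    ·-units C x y = trans (·-+ C (unitℚ i x) (unitℚ j y)) (cong₂ ℚ._+_ (·-unit C i x) (·-unit C j y))

  -- Cramer's rule.
  dualBasis : Vector (Vector ℚ l) 2
  dualBasis 0F k = unitℚ i (B j ℚ.* 1/ D) k ℚ.+ unitℚ j (ℚ.- B i ℚ.* 1/ D) k
  dualBasis 1F k = unitℚ i (ℚ.- A j ℚ.* 1/ D) k ℚ.+ unitℚ j (A i ℚ.* 1/ D) k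

  A·b₀ : A · dualBasis 0F ≡ 1ℚ
  A·b₀ = trans (·-units A _ _) (trans
    (solve 5 (λ a b c d e → d :* e :* a :+ :- c :* e :* b := (a :* d :- b :* c) :* e) refl
      (A i) (A j) (B i) (B j) (1/ D))
    (ℚ.*-inverseʳ D))

  A·b₁ : A · dualBasis 1F ≡ 0ℚ
  A·b₁ = trans (·-units A _ _)
    (solve 3 (λ a b e → :- b :* e :* a :+ a :* e :* b := con 0ℚ) refl (A i) (A j) (1/ D))

  B·b₀ : B · dualBasis 0F ≡ 0ℚ
  B·b₀ = trans (·-units B _ _)
    (solve 3 (λ c d e → d :* e :* c :+ :- c :* e :* d := con 0ℚ) refl (B i) (B j) (1/ D))

  B·b₁ : B · dualBasis 1F ≡ 1ℚ
  B·b₁ = trans (·-units B _ _) (trans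
    (solve 5 (λ a b c d e → :- b :* e :* c :+ a :* e :* d := (a :* d :- b :* c) :* e) refl
      (A i) (A j) (B i) (B j) (1/ D))
    (ℚ.*-inverseʳ D))

  A·linComb : ∀ c → A · linComb c dualBasis ≡ c 0F
  A·linComb c = begin
    A · linComb c dualBasis                                   ≡⟨ ·-linComb A c dualBasis ⟩
    c 0F ℚ.* A · dualBasis 0F ℚ.+ c 1F ℚ.* A · dualBasis 1F
      ≡⟨ cong₂ (λ x y → c 0F ℚ.* x ℚ.+ c 1F ℚ.* y) A·b₀ A·b₁ ⟩
    c 0F ℚ.* 1ℚ ℚ.+ c 1F ℚ.* 0ℚ
      ≡⟨ solve 2 (λ x y → x :* con 1ℚ :+ y :* con 0ℚ := x) refl (c 0F) (c 1F) ⟩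
    c 0F                                                      ∎
    where open ≡-Reasoning

  B·linComb : ∀ c → B · linComb c dualBasis ≡ c 1F
  B·linComb c = begin
    B · linComb c dualBasis                                   ≡⟨ ·-linComb B c dualBasis ⟩
    c 0F ℚ.* B · dualBasis 0F ℚ.+ c 1F ℚ.* B · dualBasis 1F
      ≡⟨ cong₂ (λ x y → c 0F ℚ.* x ℚ.+ c 1F ℚ.* y) B·b₀ B·b₁ ⟩
    c 0F ℚ.* 0ℚ ℚ.+ c 1F ℚ.* 1ℚ
      ≡⟨ solve 2 (λ x y → x :* con 0ℚ :+ y :* con 1ℚ := y) refl (c 0F) (c 1F) ⟩
    c 1F                                                      ∎
    where open ≡-Reasoning

-- The nonzero minor provides vectors dual to the two forms. The coordinates of v modulo the
-- intersection are then the values of the forms at v, which gives both spanning and independence.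
hasCodim-2 : (f : Vector (LinForm l) 2) {i j : Fin l} →
  f 0F i ℤ.* f 1F j ≢ f 0F j ℤ.* f 1F i → HasCodim (⋂ (Fin 2) (hyperplane ∘ f)) 2
hasCodim-2 {l} f {i} {j} minor≢0 = record
  { b           = basis
  ; spanning    = λ v → c v , λ
    { 0F → residue (A 0F) (c v) v (A·linComb (A 0F) (A 1F) minorℚ≢0 (c v))
    ; 1F → residue (A 1F) (c v) v (B·linComb (A 0F) (A 1F) minorℚ≢0 (c v))
    }
  ; independent = λ c c∈W → λ
    { 0F → trans (sym (A·linComb (A 0F) (A 1F) minorℚ≢0 c)) (c∈W 0F)
    ; 1F → trans (sym (B·linComb (A 0F) (A 1F) minorℚ≢0 c)) (c∈W 1F)
    }
  }
  where
  A : Vector (Vector ℚ l) 2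
  A m k = toℚ (f m k)

  minorℚ≢0 : A 0F i ℚ.* A 1F j ≢ A 0F j ℚ.* A 1F i
  minorℚ≢0 eq = minor≢0 (toℚ-injective
    (trans (toℚ-* (f 0F i) (f 1F j)) (trans eq (sym (toℚ-* (f 0F j) (f 1F i))))))

  basis : Vector (Vector ℚ l) 2
  basis = dualBasis (A 0F) (A 1F) minorℚ≢0

  c : Vector ℚ l → Vector ℚ 2
  c v m = A m · v

  residue : ∀ C c v → C · linComb c basis ≡ C · v → C · (λ k → v k ℚ.- linComb c basis k) ≡ 0ℚ
  residue C c v eq =
    trans (·-- C v (linComb c basis)) (trans (cong (λ t → C · v ℚ.- t) eq) (ℚ.+-inverseʳ (C · v)))

-- For an index i with a_i ≠ 0, the vanishing minors say a_i b = b_i a. Hence a_i (b · v) = b_i (a ·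
-- v) = 0, and a_i is inverted in ℚ.
minors≡0⇒⊆ : (a b : LinForm l) → (∀ i j → a i ℤ.* b j ≡ a j ℤ.* b i) →
  ¬ (∀ i → a i ≡ 0ℤ) → hyperplane a ⊆ hyperplane b
minors≡0⇒⊆ {l} a b minors≡0 a≢0 {v} a·v≡0
  with i , aᵢ≢0 ← Fin.¬∀⟶∃¬ l (λ i → a i ≡ 0ℤ) (λ i → a i ℤ.≟ 0ℤ) a≢0 = begin
    B · v                          ≡⟨ ℚ.*-identityˡ _ ⟨
    1ℚ ℚ.* B · v                   ≡⟨ cong (ℚ._* (B · v)) (ℚ.*-inverseˡ (A i)) ⟨
    1/ A i ℚ.* A i ℚ.* B · v       ≡⟨ ℚ.*-assoc (1/ A i) (A i) (B · v) ⟩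
    1/ A i ℚ.* (A i ℚ.* B · v)     ≡⟨ cong (1/ A i ℚ.*_) proportional ⟩
    1/ A i ℚ.* (B i ℚ.* A · v)     ≡⟨ cong (λ t → 1/ A i ℚ.* (B i ℚ.* t)) a·v≡0 ⟩
    1/ A i ℚ.* (B i ℚ.* 0ℚ)        ≡⟨ cong (1/ A i ℚ.*_) (ℚ.*-zeroʳ (B i)) ⟩
    1/ A i ℚ.* 0ℚ                  ≡⟨ ℚ.*-zeroʳ (1/ A i) ⟩
    0ℚ                             ∎
    where
    open ≡-Reasoning

    A B : Vector ℚ l
    A = toℚ ∘ a
    B = toℚ ∘ b

    instance
      Aᵢ-nonZero : ℚ.NonZero (A i)
      Aᵢ-nonZero = ℚ.≢-nonZero (aᵢ≢0 ∘ toℚ-injective)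

    term : ∀ k → B k ℚ.* (A i ℚ.* v k) ≡ A k ℚ.* (B i ℚ.* v k)
    term k = trans (sym (ℚ.*-assoc (B k) (A i) (v k))) (trans (cong (ℚ._* v k) (begin
      B k ℚ.* A i        ≡⟨ ℚ.*-comm (B k) (A i) ⟩
      A i ℚ.* B k        ≡⟨ toℚ-* (a i) (b k) ⟨
      toℚ (a i ℤ.* b k)  ≡⟨ cong toℚ (minors≡0 i k) ⟩
      toℚ (a k ℤ.* b i)  ≡⟨ toℚ-* (a k) (b i) ⟩
      A k ℚ.* B i        ∎)) (ℚ.*-assoc (A k) (B i) (v k)))

    proportional : A i ℚ.* B · v ≡ B i ℚ.* A · v
    proportional = begin
      A i ℚ.* B · v                ≡⟨ ·-*ˡ B (A i) v ⟨
      B · (λ k → A i ℚ.* v k)      ≡⟨ ∑ℚ-cong term ⟩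
      A · (λ k → B i ℚ.* v k)      ≡⟨ ·-*ˡ A (B i) v ⟩
      B i ℚ.* A · v                ∎

-- A finite search decides whether such a minor exists; if all vanish, each hyperplane contains the
-- other.
nonzero-minor : (a b : LinForm l) → ¬ (∀ i → a i ≡ 0ℤ) → ¬ (∀ i → b i ≡ 0ℤ) →
  ¬ hyperplane a ≐ hyperplane b → ∃[ i ] ∃[ j ] a i ℤ.* b j ≢ a j ℤ.* b i
nonzero-minor a b a≢0 b≢0 a≭b
  with Fin.any? (λ i → Fin.any? (λ j → ¬? (a i ℤ.* b j ℤ.≟ a j ℤ.* b i)))
... | yes minor = minor
... | no ¬minor = contradiction a≐b a≭b
  where
  minors≡0 : ∀ i j → a i ℤ.* b j ≡ a j ℤ.* b i
  minors≡0 i j = decidable-stable (a i ℤ.* b j ℤ.≟ a j ℤ.* b i) λ ≢ → ¬minor (i , j , ≢)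

  a≐b : hyperplane a ≐ hyperplane b
  a≐b = (λ {v} → minors≡0⇒⊆ a b minors≡0 a≢0 {v})
      , (λ {v} → minors≡0⇒⊆ b a
          (λ i j → trans (ℤ.*-comm (b i) (a j)) (trans (minors≡0 j i) (ℤ.*-comm (a i) (b j)))) b≢0 {v})

-- The ideal of two linear forms

infixl 6 _+ᴸ_
infixr 7 _·ᴸ_

_+ᴸ_ : LinForm l → LinForm l → LinForm l
(a +ᴸ b) k = a k + b k

_·ᴸ_ : ℤ → LinForm l → LinForm l
(u ·ᴸ a) k = u * a k

pairing-toPoly-+ : (a b : LinForm l) (F : Mon l → ℤ) →
  ⟪ toPoly (a +ᴸ b) , F ⟫ ≡ ⟪ toPoly a , F ⟫ + ⟪ toPoly b , F ⟫
pairing-toPoly-+ {l} a b F = begin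
  ⟪ toPoly (a +ᴸ b) , F ⟫
    ≡⟨ pairing-toPoly (a +ᴸ b) F ⟩
  sum (λ k → (a k + b k) * F (var k))
    ≡⟨ sum-cong-≗ (λ k → ℤ.*-distribʳ-+ (F (var k)) (a k) (b k)) ⟩
  sum (λ k → a k * F (var k) + b k * F (var k))
    ≡⟨ ∑-distrib-+ {l} (λ k → a k * F (var k)) (λ k → b k * F (var k)) ⟩
  sum (λ k → a k * F (var k)) + sum (λ k → b k * F (var k))
    ≡⟨ cong₂ _+_ (pairing-toPoly a F) (pairing-toPoly b F) ⟨
  ⟪ toPoly a , F ⟫ + ⟪ toPoly b , F ⟫
    ∎
  where open ≡-Reasoning

pairing-toPoly-· : (u : ℤ) (a : LinForm l) (F : Mon l → ℤ) → ⟪ toPoly (u ·ᴸ a) , F ⟫ ≡ u * ⟪ toPoly a , F ⟫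
pairing-toPoly-· {l} u a F = begin
  ⟪ toPoly (u ·ᴸ a) , F ⟫              ≡⟨ pairing-toPoly (u ·ᴸ a) F ⟩
  sum (λ k → u * a k * F (var k))      ≡⟨ sum-cong-≗ (λ k → ℤ.*-assoc u (a k) (F (var k))) ⟩
  sum (λ k → u * (a k * F (var k)))    ≡⟨ *-distribˡ-sum {l} u (λ k → a k * F (var k)) ⟨
  u * sum (λ k → a k * F (var k))      ≡⟨ cong (u *_) (pairing-toPoly a F) ⟨
  u * ⟪ toPoly a , F ⟫                 ∎
  where open ≡-Reasoning

coeff-toPoly-support : (a : LinForm l) {m : Mon l} → coeff (toPoly a) m ≢ 0ℤ → ∃[ j ] m ≡ var j
coeff-toPoly-support a {m} c≢0 = ∈-tabulate⁻
  (subst (_ ∈ˡ_) (List.map-tabulate (λ j → a j , var j) proj₂) (coeff-support (toPoly a) c≢0))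

coeff-++ : (f g : Poly l) (m : Mon l) → coeff (f ++ g) m ≡ coeff f m + coeff g m
coeff-++ f g m = begin
  coeff (f ++ g) m           ≡⟨ coeff-pairing (f ++ g) m ⟩
  ⟪ f ++ g , δ m ⟫           ≡⟨ pairing-++ f g (δ m) ⟩
  ⟪ f , δ m ⟫ + ⟪ g , δ m ⟫  ≡⟨ cong₂ _+_ (coeff-pairing f m) (coeff-pairing g m) ⟨
  coeff f m + coeff g m      ∎
  where open ≡-Reasoning

*ᴹ≡var⇒ : (j : Fin l) {x m : Mon l} → x *ᴹ m ≡ var j → m ≡ 1ᴹ ⊎ m ≡ var j
*ᴹ≡var⇒ zero {n ∷ x} {k ∷ m} eq =
  Sum.map (λ k≡0 → cong₂ _∷_ k≡0 m≡1) (λ k≡1 → cong₂ _∷_ k≡1 m≡1) (split n k (Vec.∷-injectiveˡ eq))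
  where
  split : ∀ n k → n ℕ.+ k ≡ 1 → k ≡ 0 ⊎ k ≡ 1
  split zero    k eq = inj₂ eq
  split (suc n) k eq = inj₁ (ℕ.m+n≡0⇒n≡0 n (ℕ.suc-injective eq))

  factor-1 : ∀ {l} {x m : Mon l} → x *ᴹ m ≡ 1ᴹ → m ≡ 1ᴹ
  factor-1 {x = []}    {[]}    _  = refl
  factor-1 {x = n ∷ x} {k ∷ m} eq =
    cong₂ _∷_ (ℕ.m+n≡0⇒n≡0 n (Vec.∷-injectiveˡ eq)) (factor-1 (Vec.∷-injectiveʳ eq))

  m≡1 : m ≡ 1ᴹ
  m≡1 = factor-1 (Vec.∷-injectiveʳ eq)
*ᴹ≡var⇒ (suc j) {n ∷ x} {k ∷ m} eq =
  Sum.map (cong₂ _∷_ k≡0) (cong₂ _∷_ k≡0) (*ᴹ≡var⇒ j (Vec.∷-injectiveʳ eq))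
  where
  k≡0 = ℕ.m+n≡0⇒n≡0 n (Vec.∷-injectiveˡ eq)

-- Divisibility of a multiple of x_j by the term e m, read off one coefficient: that coefficient is
-- e times a sum over the terms of q, and the sum is empty unless m divides x_j.
term-divides : (q : Poly l) (e : ℤ) (m : Mon l) (j : Fin l) →
  coeff (q *ᴾ [ e , m ]) (var j) ≢ 0ℤ →
  e ∣ coeff (q *ᴾ [ e , m ]) (var j) × (m ≡ 1ᴹ ⊎ m ≡ var j)
term-divides q e m j c≢0 =
    divides ⟪ q , (λ x → δ (var j) (x *ᴹ m)) ⟫ (trans expand (ℤ.*-comm e _))
  , decidable-stable ((m ≟ᴹ 1ᴹ) ⊎-dec (m ≟ᴹ var j)) λ m∤ → c≢0 (trans expand (trans
      (cong (e *_) (trans (pairing-cong q λ x → δ-≢ {m = var j} {x *ᴹ m} (m∤ ∘ *ᴹ≡var⇒ j)) (pairing-zero q)))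
      (ℤ.*-zeroʳ e)))
  where
  open ≡-Reasoning
  expand : coeff (q *ᴾ [ e , m ]) (var j) ≡ e * ⟪ q , (λ x → δ (var j) (x *ᴹ m)) ⟫
  expand = begin
    coeff (q *ᴾ [ e , m ]) (var j)                  ≡⟨ coeff-pairing (q *ᴾ [ e , m ]) (var j) ⟩
    ⟪ q *ᴾ [ e , m ] , δ (var j) ⟫                  ≡⟨ pairing-* q [ e , m ] (δ (var j)) ⟩
    ⟪ q , (λ x → e * δ (var j) (x *ᴹ m) + 0ℤ) ⟫     ≡⟨ pairing-cong q (λ x → ℤ.+-identityʳ _) ⟩
    ⟪ q , (λ x → e * δ (var j) (x *ᴹ m)) ⟫          ≡⟨ pairing-*ˡ q e _ ⟩
    e * ⟪ q , (λ x → δ (var j) (x *ᴹ m)) ⟫          ∎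

generator∈⟨⟩ : ∀ {n} (G : Vector (Poly l) n) (i : Fin n) → G i ∈ ⟨ G ⟩
generator∈⟨⟩ {l} {n} G i = unit 𝔽₀ i [ 1ℤ , 1ᴹ ] , λ m →
  sym (ℤ.i-j≡0⇒i≡j _ _ (ℤ.0∣⇒≡0 (difference (coeff-cong sum≋G m))))
  where
  -- Congruence modulo 0 is equality.
  open Mod 0
  𝔽₀ = ≋-commutativeSemiring l
  open CommutativeSemiring 𝔽₀ using (*-identityˡ) renaming (trans to ≋-trans)
  open SemiringDefs (ℤ[x] l) renaming (sum to sumᴾ)

  sum≋G : sumᴾ (λ k → unit 𝔽₀ i [ 1ℤ , 1ᴹ ] k *ᴾ G k) ≋ G i
  sum≋G = ≋-trans (sum-unit 𝔽₀ i [ 1ℤ , 1ᴹ ] G) (*-identityˡ (G i))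

module _ (f : Vector (LinForm l) 2) where

  linear∈⟨⟩ : ∀ u v → toPoly (u ·ᴸ f 0F +ᴸ v ·ᴸ f 1F) ∈ ⟨ toPoly ∘ f ⟩
  linear∈⟨⟩ u v = q , λ m →
    trans (coeff-pairing (toPoly (u ·ᴸ f 0F +ᴸ v ·ᴸ f 1F)) m) (trans (expand (δ m))
      (sym (coeff-pairing (q 0F *ᴾ toPoly (f 0F) ++ (q 1F *ᴾ toPoly (f 1F) ++ [])) m)))
    where
    open ≡-Reasoning

    q : Vector (Poly l) 2
    q 0F = [ u , 1ᴹ ]
    q 1F = [ v , 1ᴹ ]

    expand : ∀ F → ⟪ toPoly (u ·ᴸ f 0F +ᴸ v ·ᴸ f 1F) , F ⟫ ≡
      ⟪ q 0F *ᴾ toPoly (f 0F) ++ (q 1F *ᴾ toPoly (f 1F) ++ []) , F ⟫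
    expand F = begin
      ⟪ toPoly (u ·ᴸ f 0F +ᴸ v ·ᴸ f 1F) , F ⟫
        ≡⟨ pairing-toPoly-+ (u ·ᴸ f 0F) (v ·ᴸ f 1F) F ⟩
      ⟪ toPoly (u ·ᴸ f 0F) , F ⟫ + ⟪ toPoly (v ·ᴸ f 1F) , F ⟫
        ≡⟨ cong₂ _+_ (pairing-toPoly-· u (f 0F) F) (pairing-toPoly-· v (f 1F) F) ⟩
      u * ⟪ toPoly (f 0F) , F ⟫ + v * ⟪ toPoly (f 1F) , F ⟫
        ≡⟨ cong₂ _+_ (pairing-constant-* u (toPoly (f 0F)) F) (pairing-constant-* v (toPoly (f 1F)) F) ⟨
      ⟪ q 0F *ᴾ toPoly (f 0F) , F ⟫ + ⟪ q 1F *ᴾ toPoly (f 1F) , F ⟫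
        ≡⟨ cong (λ g → ⟪ q 0F *ᴾ toPoly (f 0F) , F ⟫ + ⟪ g , F ⟫)
             (List.++-identityʳ (q 1F *ᴾ toPoly (f 1F))) ⟨
      ⟪ q 0F *ᴾ toPoly (f 0F) , F ⟫ + ⟪ q 1F *ᴾ toPoly (f 1F) ++ [] , F ⟫
        ≡⟨ pairing-++ (q 0F *ᴾ toPoly (f 0F)) (q 1F *ᴾ toPoly (f 1F) ++ []) F ⟨
      ⟪ q 0F *ᴾ toPoly (f 0F) ++ (q 1F *ᴾ toPoly (f 1F) ++ []) , F ⟫
        ∎

  -- The constant terms of the cofactors are the coefficients of the combination. So the linear
  -- parts of members of the ideal are integral combinations of the two generating forms.
  ⟨⟩-coeff-var : ∀ {g} → g ∈ ⟨ toPoly ∘ f ⟩ →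
    ∃[ u ] ∃[ v ] (∀ k → coeff g (var k) ≡ (u ·ᴸ f 0F +ᴸ v ·ᴸ f 1F) k)
  ⟨⟩-coeff-var {g} (q , g≈) = coeff (q 0F) 1ᴹ , coeff (q 1F) 1ᴹ , λ k → begin
    coeff g (var k)
      ≡⟨ g≈ (var k) ⟩
    coeff (q 0F *ᴾ toPoly (f 0F) ++ (q 1F *ᴾ toPoly (f 1F) ++ [])) (var k)
      ≡⟨ coeff-++ (q 0F *ᴾ toPoly (f 0F)) _ (var k) ⟩
    coeff (q 0F *ᴾ toPoly (f 0F)) (var k) + coeff (q 1F *ᴾ toPoly (f 1F) ++ []) (var k)
      ≡⟨ cong (λ t → coeff (q 0F *ᴾ toPoly (f 0F)) (var k) + coeff t (var k))
           (List.++-identityʳ (q 1F *ᴾ toPoly (f 1F))) ⟩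
    coeff (q 0F *ᴾ toPoly (f 0F)) (var k) + coeff (q 1F *ᴾ toPoly (f 1F)) (var k)
      ≡⟨ cong₂ _+_ (coeff-*-toPoly (q 0F) (f 0F) k) (coeff-*-toPoly (q 1F) (f 1F) k) ⟩
    coeff (q 0F) 1ᴹ * f 0F k + coeff (q 1F) 1ᴹ * f 1F k
      ∎
    where open ≡-Reasoning

  ⟨⟩-coeff-1 : ∀ {g} → g ∈ ⟨ toPoly ∘ f ⟩ → coeff g 1ᴹ ≡ 0ℤ
  ⟨⟩-coeff-1 {g} (q , g≈) = begin
    coeff g 1ᴹ
      ≡⟨ g≈ 1ᴹ ⟩
    coeff (q 0F *ᴾ toPoly (f 0F) ++ (q 1F *ᴾ toPoly (f 1F) ++ [])) 1ᴹ
      ≡⟨ coeff-++ (q 0F *ᴾ toPoly (f 0F)) _ 1ᴹ ⟩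
    coeff (q 0F *ᴾ toPoly (f 0F)) 1ᴹ + coeff (q 1F *ᴾ toPoly (f 1F) ++ []) 1ᴹ
      ≡⟨ cong (λ t → coeff (q 0F *ᴾ toPoly (f 0F)) 1ᴹ + coeff t 1ᴹ)
           (List.++-identityʳ (q 1F *ᴾ toPoly (f 1F))) ⟩
    coeff (q 0F *ᴾ toPoly (f 0F)) 1ᴹ + coeff (q 1F *ᴾ toPoly (f 1F)) 1ᴹ
      ≡⟨ cong₂ _+_ (coeff-*-toPoly-1 (q 0F) (f 0F)) (coeff-*-toPoly-1 (q 1F) (f 1F)) ⟩
    0ℤ
      ∎
    where open ≡-Reasoning

-- Lucky primes

var-injective : {j k : Fin l} → var j ≡ var k → j ≡ k
var-injective {j = j} {k} eq = proj₂ (*ᴹ-var⁻¹ j k (trans (*ᴹ-identityˡ (var j)) eq))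

module _ (σ : TermOrder l) where

  open TermOrder σ
  private module ≼ = IsTotalOrder isTotalOrder

  IsLargestVar : LinForm l → Fin l → Set
  IsLargestVar h j = h j ≢ 0ℤ × (∀ {k} → h k ≢ 0ℤ → var k ≼ var j)

  lpp-toPoly : (h : LinForm l) {i : Fin l} → h i ≢ 0ℤ →
    ∃[ j ] lpp σ (toPoly h) ≡ var j × IsLargestVar h j
  lpp-toPoly h {i} hᵢ≢0 = locate (lpp-isLargest σ (toPoly h) (hᵢ≢0 ∘ trans (sym (coeff-toPoly h i))))
    where
    locate : IsLargest σ (λ m → coeff (toPoly h) m ≢ 0ℤ) (lpp σ (toPoly h)) →
      ∃[ j ] lpp σ (toPoly h) ≡ var j × IsLargestVar h j
    locate (c≢0 , ≼lpp) with j , lpp≡xⱼ ← coeff-toPoly-support h c≢0 =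
        j , lpp≡xⱼ
      , subst (_≢ 0ℤ) (trans (cong (coeff (toPoly h)) lpp≡xⱼ) (coeff-toPoly h j)) c≢0
      , λ {k} hₖ≢0 → subst (var k ≼_) lpp≡xⱼ (≼lpp (hₖ≢0 ∘ trans (sym (coeff-toPoly h k))))

  zero-or-largestVar : (h : LinForm l) → (∀ k → h k ≡ 0ℤ) ⊎ ∃[ j ] IsLargestVar h j
  zero-or-largestVar h with Fin.any? (λ k → ¬? (h k ℤ.≟ 0ℤ))
  ... | yes (_ , hₖ≢0) = inj₂ (map₂ proj₂ (lpp-toPoly h hₖ≢0))
  ... | no  ¬∃         = inj₁ λ k → decidable-stable (h k ℤ.≟ 0ℤ) λ hₖ≢0 → ¬∃ (k , hₖ≢0)

  _⊑_ : Fin l → Fin l → Set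
  j ⊑ k = var j ≼ var k

  -- The order induced by σ on the indices of variables. As these are finite in number, its strict
  -- part is well-founded, which ends the reduction with no appeal to well-foundedness of σ.
  ⊑-isPartialOrder : IsPartialOrder _≡_ _⊑_
  ⊑-isPartialOrder = record
    { isPreorder = record
      { isEquivalence = isEquivalence
      ; reflexive     = λ { refl → ≼.refl }
      ; trans         = ≼.trans
      }
    ; antisym    = λ j⊑k k⊑j → var-injective (≼.antisym j⊑k k⊑j)
    }

  -- Reduction of linear forms by a Gröbner basis with leading coefficients prime to p.

  module _ {p : ℕ} (p-prime : Prime p) (f : Vector (LinForm l) 2) {i j : Fin l}
           (minor≢0 : f 0F i * f 1F j ≢ f 0F j * f 1F i) where

    open Mod p
    open ModPrime σ p p-prime

    private
      instance
        p-nonZero : ℤ.NonZero (ℤ.+ p)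
        p-nonZero = prime⇒nonZero p-prime

      combination : ℤ → ℤ → LinForm l
      combination u v = u ·ᴸ f 0F +ᴸ v ·ᴸ f 1F

    -- Eliminating one unknown from the entries at i and j leaves u or v times the nonzero minor
    -- `D`.
    combination-injective : ∀ u v → (∀ k → combination u v k ≡ 0ℤ) → u ≡ 0ℤ × v ≡ 0ℤ
    combination-injective u v ≡0 = cancel u (begin
        u * D  ≡⟨ eliminate-v u v (a i) (a j) (b i) (b j) ⟩
        b j * combination u v i - b i * combination u v j
          ≡⟨ cong₂ (λ x y → b j * x - b i * y) (≡0 i) (≡0 j) ⟩
        b j * 0ℤ - b i * 0ℤ  ≡⟨ vanish (b i) (b j) ⟩
        0ℤ  ∎) , cancel v (begin
        v * D  ≡⟨ eliminate-u u v (a i) (a j) (b i) (b j) ⟩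
        a i * combination u v j - a j * combination u v i
          ≡⟨ cong₂ (λ x y → a i * x - a j * y) (≡0 j) (≡0 i) ⟩
        a i * 0ℤ - a j * 0ℤ  ≡⟨ vanish (a j) (a i) ⟩
        0ℤ  ∎)
      where
      open ≡-Reasoning
      a = f 0F
      b = f 1F

      D : ℤ
      D = a i * b j - a j * b i

      cancel : ∀ x → x * D ≡ 0ℤ → x ≡ 0ℤ
      cancel x xD≡0 with ℤ.i*j≡0⇒i≡0∨j≡0 x xD≡0
      ... | inj₁ x≡0 = x≡0
      ... | inj₂ D≡0 = contradiction (ℤ.i-j≡0⇒i≡j _ _ D≡0) minor≢0

      eliminate-v : ∀ u v aᵢ aⱼ bᵢ bⱼ →
        u * (aᵢ * bⱼ - aⱼ * bᵢ) ≡ bⱼ * (u * aᵢ + v * bᵢ) - bᵢ * (u * aⱼ + v * bⱼ)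
      eliminate-v = solve-∀

      eliminate-u : ∀ u v aᵢ aⱼ bᵢ bⱼ →
        v * (aᵢ * bⱼ - aⱼ * bᵢ) ≡ aᵢ * (u * aⱼ + v * bⱼ) - aⱼ * (u * aᵢ + v * bᵢ)
      eliminate-u = solve-∀

      vanish : ∀ x y → y * 0ℤ - x * 0ℤ ≡ 0ℤ
      vanish = solve-∀

    -- From p x = t e and p ∤ e, the prime p divides t and can be cancelled.
    ∣*⇒∣ : ∀ {e x} → ¬ ℤ.+ p ∣ e → e ∣ ℤ.+ p * x → e ∣ x
    ∣*⇒∣ {e} {x} p∤e (divides t px≡te)
      with prime-split {t} {e} (∣⇒≈0 (divides x (trans (sym px≡te) (ℤ.*-comm (ℤ.+ p) x))))
    ... | inj₂ e≈0 = contradiction (≈0⇒∣ e≈0) p∤e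
    ... | inj₁ t≈0 with divides t′ t≡t′p ← ≈0⇒∣ t≈0 = divides t′ (ℤ.*-cancelˡ-≡ (ℤ.+ p) x (t′ * e) (begin
      ℤ.+ p * x         ≡⟨ px≡te ⟩
      t * e             ≡⟨ cong (_* e) t≡t′p ⟩
      t′ * ℤ.+ p * e    ≡⟨ rearrange t′ (ℤ.+ p) e ⟩
      ℤ.+ p * (t′ * e)  ∎))
      where
      open ≡-Reasoning
      rearrange : ∀ t p e → t * p * e ≡ p * (t * e)
      rearrange = solve-∀

    module _ (lucky : IsLucky σ p ⟨ toPoly ∘ f ⟩) where

      private
        G = proj₁ (proj₂ lucky)
        open IsMinimalStrongGröbnerBasis (proj₁ (proj₂ (proj₂ lucky)))

      -- Only the linear part of a reducing basis element is recorded. Subtracting t times it clears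
      -- the coefficient of h at x_j and introduces no variable above x_j.
      Reducer : LinForm l → Fin l → Set
      Reducer h j = ∃[ t ] ∃[ u′ ] ∃[ v′ ] h j ≡ t * combination u′ v′ j
        × (∀ {k} → combination u′ v′ k ≢ 0ℤ → var k ≼ var j)

      -- The form p h lies in the ideal and leads with p h_j x_j, so some `LM σ g` divides this
      -- term. The leading coefficient of g divides p h_j and, being prime to p by luckiness,
      -- already divides h_j. The leading power product of g is 1 or x_j; the value 1 is excluded
      -- because members of the ideal have constant term 0.
      lucky-reducer : ∀ h u v {j} → IsLargestVar h j → (∀ k → ℤ.+ p * h k ≡ combination u v k) → Reducer h j
      lucky-reducer h u v {j} (hⱼ≢0 , h≼) ph≡ = fromDivisor (strong {ph} (linear∈⟨⟩ f u v) ph≉0)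
        where
        open SemiringDefs (ℤ[x] l) using () renaming (_∣_ to _∣ᴾ_)
        ph : Poly l
        ph = toPoly (combination u v)

        phⱼ : coeff ph (var j) ≡ ℤ.+ p * h j
        phⱼ = trans (coeff-toPoly (combination u v) j) (sym (ph≡ j))

        phⱼ≢0 : coeff ph (var j) ≢ 0ℤ
        phⱼ≢0 phⱼ≡0 = hⱼ≢0 (ℤ.*-cancelˡ-≡ (ℤ.+ p) (h j) 0ℤ
          (trans (sym phⱼ) (trans phⱼ≡0 (sym (ℤ.*-zeroʳ (ℤ.+ p))))))

        ph≉0 : ¬ (coeff ph ≗ coeff [])
        ph≉0 ph≈0 = phⱼ≢0 (ph≈0 (var j))

        -- Multiplication by p ≠ 0 preserves the support, so p h and h have the same largest
        -- variable.
        lpp≡ : lpp σ ph ≡ var j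
        lpp≡ = locate (lpp-toPoly (combination u v) (phⱼ≢0 ∘ trans (coeff-toPoly _ j)))
          where
          locate : ∃[ k ] lpp σ ph ≡ var k × IsLargestVar (combination u v) k → lpp σ ph ≡ var j
          locate (k , lpp≡xₖ , cₖ≢0 , c≼) =
            trans lpp≡xₖ (≼.antisym (h≼ hₖ≢0) (c≼ (phⱼ≢0 ∘ trans (coeff-toPoly _ j))))
            where
            hₖ≢0 : h k ≢ 0ℤ
            hₖ≢0 hₖ≡0 = cₖ≢0 (trans (sym (ph≡ k)) (trans (cong (ℤ.+ p *_) hₖ≡0) (ℤ.*-zeroʳ (ℤ.+ p))))

        fromDivisor : ∃[ n ] LM σ (G n) ∣ᴾ LM σ ph → Reducer h j
        fromDivisor (n , q , eq) = reducer (⟨⟩-coeff-var f {g} g∈I)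
          where
          g : Poly l
          g = G n

          g∈I : g ∈ ⟨ toPoly ∘ f ⟩
          g∈I = proj₂ generates {g} (generator∈⟨⟩ G n)

          p∤LC : ¬ ℤ.+ p ∣ LC σ g
          p∤LC = proj₂ (proj₂ (proj₂ lucky)) n ∘ ℤ.∣⇒∣ᵤ

          LC≢0 : LC σ g ≢ 0ℤ
          LC≢0 LC≡0 = p∤LC (subst (ℤ.+ p ∣_) (sym LC≡0) k∣0)

          coeff-q*LM : coeff (q *ᴾ LM σ g) (var j) ≡ ℤ.+ p * h j
          coeff-q*LM = begin
            coeff (q *ᴾ LM σ g) (var j)  ≡⟨ eq (var j) ⟩
            coeff [ coeff ph (lpp σ ph) , lpp σ ph ] (var j)
              ≡⟨ cong (λ m → coeff [ coeff ph m , m ] (var j)) lpp≡ ⟩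
            coeff [ coeff ph (var j) , var j ] (var j)
              ≡⟨ coeff-pairing [ coeff ph (var j) , var j ] (var j) ⟩
            coeff ph (var j) * δ (var j) (var j) + 0ℤ
              ≡⟨ cong (λ t → coeff ph (var j) * t + 0ℤ) (δ-refl (var j)) ⟩
            coeff ph (var j) * 1ℤ + 0ℤ   ≡⟨ simplify (coeff ph (var j)) ⟩
            coeff ph (var j)             ≡⟨ phⱼ ⟩
            ℤ.+ p * h j                  ∎
            where
            open ≡-Reasoning
            simplify : ∀ x → x * 1ℤ + 0ℤ ≡ x
            simplify = solve-∀

          coeff-q*LM≢0 : coeff (q *ᴾ LM σ g) (var j) ≢ 0ℤ
          coeff-q*LM≢0 ≡0 = phⱼ≢0 (trans phⱼ (trans (sym coeff-q*LM) ≡0))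

          division : LC σ g ∣ coeff (q *ᴾ LM σ g) (var j) × (lpp σ g ≡ 1ᴹ ⊎ lpp σ g ≡ var j)
          division = term-divides q (LC σ g) (lpp σ g) j coeff-q*LM≢0

          LC∣hⱼ : LC σ g ∣ h j
          LC∣hⱼ = ∣*⇒∣ p∤LC (subst (LC σ g ∣_) coeff-q*LM (proj₁ division))

          lpp-g≡ : lpp σ g ≡ var j
          lpp-g≡ = Sum.fromInj₂
            (λ lpp≡1 → contradiction (trans (cong (coeff g) lpp≡1) (⟨⟩-coeff-1 f {g} g∈I)) LC≢0)
            (proj₂ division)

          reducer : (∃[ u′ ] ∃[ v′ ] (∀ k → coeff g (var k) ≡ combination u′ v′ k)) → Reducer h j
          reducer (u′ , v′ , g≡) =
              ℤ.quotient LC∣hⱼ , u′ , v′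
            , trans (ℤ._∣_.equality LC∣hⱼ) (cong (ℤ.quotient LC∣hⱼ *_) (trans (cong (coeff g) lpp-g≡) (g≡ j)))
            , λ {k} c≢0 → subst (var k ≼_) lpp-g≡ (proj₂ (lpp-isLargest σ g LC≢0) (c≢0 ∘ trans (sym (g≡ k))))

      -- Each reduction subtracts t times the linear part of a basis element from h, which changes u
      -- and v by multiples of p only. At the end h = 0, where u = v = 0 by independence; going back
      -- up, p divides the original u and v.
      combination-divisible : ∀ h u v → (∀ k → ℤ.+ p * h k ≡ combination u v k) → ℤ.+ p ∣ u × ℤ.+ p ∣ v
      combination-divisible h u v ph≡ = start (zero-or-largestVar h)
        where
        zero-case : ∀ h u v → (∀ k → ℤ.+ p * h k ≡ combination u v k) → (∀ k → h k ≡ 0ℤ) →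
          ℤ.+ p ∣ u × ℤ.+ p ∣ v
        zero-case h u v ph≡ h≡0 = ≡0⇒∣ (proj₁ u,v≡0) , ≡0⇒∣ (proj₂ u,v≡0)
          where
          u,v≡0 : u ≡ 0ℤ × v ≡ 0ℤ
          u,v≡0 = combination-injective u v
            λ k → trans (sym (ph≡ k)) (trans (cong (ℤ.+ p *_) (h≡0 k)) (ℤ.*-zeroʳ (ℤ.+ p)))

          ≡0⇒∣ : ∀ {x} → x ≡ 0ℤ → ℤ.+ p ∣ x
          ≡0⇒∣ refl = k∣0

        reduce : ∀ {j} → Acc _ j → ∀ h u v → IsLargestVar h j →
          (∀ k → ℤ.+ p * h k ≡ combination u v k) → ℤ.+ p ∣ u × ℤ.+ p ∣ v
        reduce {j} (acc rec) h u v (hⱼ≢0 , h≼) ph≡ = subtract (lucky-reducer h u v (hⱼ≢0 , h≼) ph≡)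
          where
          subtract : Reducer h j → ℤ.+ p ∣ u × ℤ.+ p ∣ v
          subtract (t , u′ , v′ , hⱼ≡ , c≼) = undo (continue (zero-or-largestVar h′))
            where
            h′ : LinForm l
            h′ k = h k - t * combination u′ v′ k

            ph′≡ : ∀ k → ℤ.+ p * h′ k ≡ combination (u - ℤ.+ p * (t * u′)) (v - ℤ.+ p * (t * v′)) k
            ph′≡ k = begin
              ℤ.+ p * h′ k
                ≡⟨ distribute (ℤ.+ p) (h k) t (combination u′ v′ k) ⟩
              ℤ.+ p * h k - ℤ.+ p * (t * combination u′ v′ k)
                ≡⟨ cong (λ x → x - ℤ.+ p * (t * combination u′ v′ k)) (ph≡ k) ⟩
              combination u v k - ℤ.+ p * (t * combination u′ v′ k)
                ≡⟨ collect (ℤ.+ p) t u v u′ v′ (f 0F k) (f 1F k) ⟩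
              combination (u - ℤ.+ p * (t * u′)) (v - ℤ.+ p * (t * v′)) k
                ∎
              where
              open ≡-Reasoning
              distribute : ∀ p x t y → p * (x - t * y) ≡ p * x - p * (t * y)
              distribute = solve-∀

              collect : ∀ p t u v u′ v′ a b → (u * a + v * b) - p * (t * (u′ * a + v′ * b)) ≡
                (u - p * (t * u′)) * a + (v - p * (t * v′)) * b
              collect = solve-∀

            h′ⱼ≡0 : h′ j ≡ 0ℤ
            h′ⱼ≡0 = ℤ.i≡j⇒i-j≡0 hⱼ≡

            h′≼ : ∀ {k} → h′ k ≢ 0ℤ → var k ≼ var j
            h′≼ {k} h′ₖ≢0 with h k ℤ.≟ 0ℤ | combination u′ v′ k ℤ.≟ 0ℤ
            ... | no  hₖ≢0 | _        = h≼ hₖ≢0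
            ... | yes _    | no  cₖ≢0 = c≼ cₖ≢0
            ... | yes hₖ≡0 | yes cₖ≡0 = contradiction
              (trans (cong₂ (λ x y → x - t * y) hₖ≡0 cₖ≡0) (cong (λ x → 0ℤ - x) (ℤ.*-zeroʳ t))) h′ₖ≢0

            continue : (∀ k → h′ k ≡ 0ℤ) ⊎ ∃[ j′ ] IsLargestVar h′ j′ →
              ℤ.+ p ∣ u - ℤ.+ p * (t * u′) × ℤ.+ p ∣ v - ℤ.+ p * (t * v′)
            continue (inj₁ h′≡0) =
              zero-case h′ (u - ℤ.+ p * (t * u′)) (v - ℤ.+ p * (t * v′)) ph′≡ h′≡0
            continue (inj₂ (j′ , h′ⱼ≢0 , largest)) =
              -- The new largest variable is at most x_j, and differs from it because the
              -- coefficient there has become 0.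
              reduce (rec (h′≼ h′ⱼ≢0 , λ { refl → h′ⱼ≢0 h′ⱼ≡0 }))
                h′ (u - ℤ.+ p * (t * u′)) (v - ℤ.+ p * (t * v′)) (h′ⱼ≢0 , largest) ph′≡

            undo : ℤ.+ p ∣ u - ℤ.+ p * (t * u′) × ℤ.+ p ∣ v - ℤ.+ p * (t * v′) → ℤ.+ p ∣ u × ℤ.+ p ∣ v
            undo (p∣u , p∣v) = add u (t * u′) p∣u , add v (t * v′) p∣v
              where
              add : ∀ x y → ℤ.+ p ∣ x - ℤ.+ p * y → ℤ.+ p ∣ x
              add x y p∣ = ℤ.∣m+n∣n⇒∣m p∣ (ℤ.∣m⇒∣-m (ℤ.∣m⇒∣m*n y ℤ.∣-refl))

        start : (∀ k → h k ≡ 0ℤ) ⊎ ∃[ j ] IsLargestVar h j → ℤ.+ p ∣ u × ℤ.+ p ∣ v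
        start (inj₁ h≡0)           = zero-case h u v ph≡ h≡0
        start (inj₂ (j , largest)) = reduce (po-wellFounded ⊑-isPartialOrder j) h u v largest ph≡

-- Both semirings have the same carrier and the same product, and their equalities are equivalent.
-- What changes is the wrapping, and unsigned against signed divisibility.
≋-squarefree⇒ : (p : ℕ) (f : Poly l) →
  Squarefree (CommutativeSemiring.rawSemiring (Mod.≋-commutativeSemiring p l)) f → Squarefree (𝔽[x] p l) f
≋-squarefree⇒ p f squarefree {g} (q , qg²≈f) = unwrap (squarefree {g} (q , coeff-injective wrapped))
  where
  open Mod p
  open SemiringDefs (𝔽[x] p _) using () renaming (_∣_ to _∣𝔽_)
  open SemiringDefs (CommutativeSemiring.rawSemiring (≋-commutativeSemiring _)) using ()
    renaming (_∣_ to _∣≋_)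

  wrapped : ∀ m → coeff (q *ᴾ (g *ᴾ g)) m ≈ₚ coeff f m
  wrapped m = congruent (ℤ.∣ᵤ⇒∣ (qg²≈f m))

  unwrap : g ∣≋ [ 1ℤ , 1ᴹ ] → g ∣𝔽 [ 1ℤ , 1ᴹ ]
  unwrap (r , rg≋1) = r , λ m → ℤ.∣⇒∣ᵤ (difference (coeff-cong rg≋1 m))

-- The forms of an arrangement at a lucky prime.

module _ (𝒜 : Arrangement n l) (σ : TermOrder l) (p : ℕ) (p-prime : Prime p) where

  open Arrangement 𝒜
  open Mod p
  open ModPrime σ p p-prime
  open SemiringDefs (CommutativeSemiring.rawSemiring (≋-commutativeSemiring l)) using (_∤_)

  -- This is primitivity of α_i at p; the finite search makes the index explicit.
  nonzero-mod-p : ∀ i → ∃[ k ] ¬ α i k ≈ₚ 0ℤ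
  nonzero-mod-p i = Fin.¬∀⟶∃¬ l (λ k → α i k ≈ₚ 0ℤ) (λ k → α i k ≈0?)
    λ α≈0 → coprime i p-prime λ k → ℤ.∣⇒∣ᵤ (≈0⇒∣ (α≈0 k))

  -- If q α_i ≡ α_j modulo p, comparing the coefficients of the variables gives c α_i - α_j = p h
  -- with c the constant term of q. Then `combination-divisible` with u = c and v = -1 forces p to
  -- divide -1. Distinctness of the hyperplanes supplies the nonzero minor, hence codimension 2 and
  -- luckiness of the ideal.
  lucky⇒∤ : IsLuckyFor 𝒜 σ 2 p → ∀ {i j} → i Fin.< j → toPoly (α i) ∤ toPoly (α j)
  lucky⇒∤ lucky {i} {j} i<j (q , qαᵢ≋αⱼ) = p∤-1
    (proj₂ (combination-divisible σ p-prime (α ∘ s) minor≢0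
      (lucky s s-increasing (hasCodim-2 (α ∘ s) minor≢0))
      (λ k → ℤ.quotient (p∣ k)) c (- 1ℤ)
      λ k → trans (ℤ.*-comm (ℤ.+ p) _) (trans (sym (ℤ._∣_.equality (p∣ k))) (rearrange c (α i k) (α j k)))))
    where
    c : ℤ
    c = coeff q 1ᴹ

    s : Fin 2 → Fin n
    s 0F = i
    s 1F = j

    s-increasing : s Preserves Fin._<_ ⟶ Fin._<_
    s-increasing {0F} {1F} _       = i<j
    s-increasing {1F} {1F} (ℕ.s≤s ())

    p∣ : ∀ k → ℤ.+ p ∣ c * α i k - α j k
    p∣ k = difference (subst₂ _≈ₚ_ (coeff-*-toPoly q (α i) k) (coeff-toPoly (α j) k)
      (coeff-cong qαᵢ≋αⱼ (var k)))

    rearrange : ∀ c x y → c * x - y ≡ c * x + - 1ℤ * y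
    rearrange = solve-∀

    minor = nonzero-minor (α i) (α j) (nonzero i) (nonzero j) (distinct (Fin.<⇒≢ i<j))
    minor≢0 = proj₂ (proj₂ minor)

    p∤-1 : ¬ ℤ.+ p ∣ - 1ℤ
    p∤-1 p∣-1 = 0≉1 σ p p-prime (≈ₚ-sym (∣⇒≈0 (ℤ.∣m⇒∣-m p∣-1)))

theorem6p3 : ∀ {n l : ℕ} (𝒜 : Arrangement n l) (σ : TermOrder l) (p : ℕ) → Prime p →
    IsLuckyFor 𝒜 σ 2 p → IsGood 𝒜 p
theorem6p3 {l = l} 𝒜 σ p p-prime lucky =
  ≋-squarefree⇒ p Q (squarefree-product (Mod.≋-commutativeSemiring p l) (toPoly ∘ α)
    (λ i → toPoly-prime σ p p-prime (α i) (proj₂ (nonzero-mod-p 𝒜 σ p p-prime i)))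
    (λ i → *-cancelˡ-≋ σ p p-prime (toPoly (α i))
      (toPoly-≉0 σ p p-prime (α i) (proj₂ (nonzero-mod-p 𝒜 σ p p-prime i))))
    (lucky⇒∤ 𝒜 σ p p-prime lucky))
  where open Arrangement 𝒜
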